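{- Let $\alpha_k=(-1)^{\lfloor(4k+1)/3\rfloor}q^{k(k-2)/3}(1+q+\cdots+q^{2k})$ if $k\not\equiv1\pmod 3$ and $\alpha_k=0$ if $k\equiv1\pmod3$. Then for every integer $p\ge1$, every positive integer $N$ and every primitive $N$th root of unity $q$, $$H_p^{(1)}(q)=-q^{ -1}(1-q)\sum_{k=0}^{N-1}(-1)^kq^{\binom{k+1}{2}+(p-1)(k^2+k)}\alpha_k.$$
   Context: $(a)_n=\prod_{k=1}^n(1-aq^{k-1})$, $\begin{bmatrix} n\\ k\end{bmatrix}=\frac{(q)_n}{(q)_{n-k}(q)_k}$. $H_p^{(1)}(q)=\sum_{n_p\ge\cdots\ge n_1\ge0}q^{n_p}(q^{n_p+1})_{n_p+1}\prod_{i=1}^{p-1}q^{n_i(n_i+1)}\begin{bmatrix} n_{i+1}\\ n_i\end{bmatrix}$; at a root of unity only finitely many terms are nonzero. (The factor $1+q+\cdots+q^{2k}$ is $\frac{1-q^{2k+1}}{1-q}$.) -}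

module Defs where

open import Level using (Level; _⊔_)
open import Algebra.Bundles using (CommutativeRing)
open import Data.Nat as ℕ using (ℕ; zero; suc; _≤_; _<_)
open import Data.Nat.DivMod using (_/_; _%_)
open import Data.Product using (_×_)
open import Data.Sum using (_⊎_)
open import Relation.Nullary using (¬_)

module Over {c ℓ : Level} (R : CommutativeRing c ℓ) where
  open CommutativeRing R

  pow : Carrier → ℕ → Carrier
  pow x zero    = 1#
  pow x (suc n) = x * pow x n

  fromℕ : ℕ → Carrier
  fromℕ zero    = 0#
  fromℕ (suc n) = 1# + fromℕ n

  signPow : ℕ → Carrier → Carrier
  signPow zero    x = x
  signPow (suc n) x = - signPow n x

  sumTo : ℕ → (ℕ → Carrier) → Carrier
  sumTo zero    f = 0#
  sumTo (suc n) f = sumTo n f + f n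

  prodTo : ℕ → (ℕ → Carrier) → Carrier
  prodTo zero    f = 1#
  prodTo (suc n) f = prodTo n f * f n

  poch : Carrier → Carrier → ℕ → Carrier
  poch q a n = prodTo n (λ i → 1# + - (a * pow q i))

  -- Gaussian (q-)binomial coefficient [n choose k], as a polynomial in q
  -- (q-Pascal recursion), evaluated at q; 0 if k > n.
  qbin : Carrier → ℕ → ℕ → Carrier
  qbin q n       zero    = 1#
  qbin q zero    (suc k) = 0#
  qbin q (suc n) (suc k) = qbin q n k + pow q (suc k) * qbin q n (suc k)

  -- G q j m = Σ_{m ≥ n_j ≥ ... ≥ n_1 ≥ 0} Π_{i=1}^{j} q^{n_i(n_i+1)} [n_{i+1} choose n_i]
  -- with n_{j+1} = m.
  G : Carrier → ℕ → ℕ → Carrier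
  G q zero    m = 1#
  G q (suc j) m = sumTo (suc m) (λ n → pow q (n ℕ.* suc n) * qbin q m n * G q j n)

  -- H_p^{(1)}(q) at a root of unity q with q^N = 1: the outer sum over n_p is
  -- truncated to n_p ≤ N - 1 (all terms with n_p ≥ N vanish since then the
  -- factor (q^{n_p+1};q)_{n_p+1} contains 1 - q^{multiple of N} = 0).
  H : ℕ → ℕ → Carrier → Carrier
  H p N q = sumTo N (λ np → pow q np * poch q (pow q (suc np)) (suc np) * G q (p ℕ.∸ 1) np)

  alpha : Carrier → ℕ → Carrier
  alpha q k with k % 3
  ... | 1 = 0#
  ... | _ = signPow ((4 ℕ.* k ℕ.+ 1) / 3)
              (pow q ((k ℕ.* (k ℕ.∸ 2)) / 3) * sumTo (suc (2 ℕ.* k)) (λ i → pow q i))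

  tri : ℕ → ℕ
  tri k = (suc k ℕ.* k) / 2

  RHSsum : ℕ → ℕ → Carrier → Carrier
  RHSsum p N q = sumTo N (λ k → signPow k
                   (pow q (tri k ℕ.+ (p ℕ.∸ 1) ℕ.* (k ℕ.* k ℕ.+ k)) * alpha q k))

  PrimitiveRoot : ℕ → Carrier → Set ℓ
  PrimitiveRoot N q = (pow q N ≈ 1#) × (∀ m → 1 ≤ m → m < N → pow q m ≉ 1#)

  IsIntegralDomainChar0 : Set (c ⊔ ℓ)
  IsIntegralDomainChar0 =
    (1# ≉ 0#) × (∀ x y → x * y ≈ 0# → (x ≈ 0#) ⊎ (y ≈ 0#)) × (∀ n → fromℕ (suc n) ≉ 0#)

{-# OPTIONS --safe #-}

-- The coefficients w_k = (-1)^k q^{C(k,2) + p(k²+k)} (1 - q^{2k+1}) come from applying the Bailey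
-- chain p times to the unit Bailey pair relative to a = q. Hence
--   (q^{n+1})_{n+1} G(n) = Σ_k w_k [2n+1 choose n-k],   H = Σ_k w_k S_k,   S_k = Σ_{n<N} q^n [2n+1 choose n-k].
-- At a primitive N-th root of unity w_{N-1-k} = - w_k, and reading S_{N-1-k} from the top end n = N-1
-- downwards, with every q^{N-i} replaced by u^i where u = 1/q, turns it into
--   u^{k+1} Σ_j (-1)^j u^{C(j,2)} [2k-j choose j]_u.
-- The two q-Pascal rules show that E_n = Σ_j (-1)^j u^{C(j,2)} [n-j choose j]_u satisfies
-- E_{n+3} = - u^{n+1} E_n, so E_{2k} is zero or a signed power of u according to k mod 3, which is the shape of α_k.

module Submission where

open import Defs
open import Level using (Level; _⊔_)
open import Algebra.Bundles using (CommutativeRing)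
open import Data.Nat as ℕ using (ℕ; zero; suc; _≤_; _<_; z≤n; s≤s)
import Data.Nat.Properties as ℕ
open import Data.Nat.DivMod using (_/_; _%_; m*n/n≡m; +-distrib-/-∣ʳ; m≡m%n+[m/n]*n; m%n<n; [m+kn]%n≡m%n)
open import Data.Nat.Divisibility using (n∣m*n)
import Data.Nat.Tactic.RingSolver as ℕSolver
open import Data.Integer as ℤ using (ℤ; +_; -[1+_])
import Data.Integer.Properties as ℤ
open import Data.Maybe.Base using (Maybe; just; nothing)
open import Data.Product using (_,_)
open import Data.Sum using (inj₁; inj₂)
open import Relation.Binary.PropositionalEquality as ≡ using (_≡_)
open import Relation.Nullary using (yes; no; contradiction)

-- The obstacle is that (q)_n is zero for n >= N, so Bailey pairs cannot be written with their usual
-- denominators. Every relation is stated with denominators cleared, and division is confined to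
-- `Cancellable`: products (q)_n with n < N, none of whose factors 1 - q^i is zero. Negative powers
-- of q are powers of `u`, so a factor such as q^(n-k) needs neither truncated subtraction nor a
-- comparison of n with k.
--
-- The reflection k -> N-1-k is what removes N from the columns: S_k has up to N-k nonzero terms, a
-- number that grows with N, whereas S_(N-1-k) has at most k+1, and q^N = 1 rids these of N
-- altogether. The antisymmetry of w_k pays for the exchange with a single sign, the one in front of
-- the theorem's right-hand side. It rests on (-1)^(N-1) q^C(N,2) = 1, found by comparing two
-- rewritings of (q)_(N-1) in powers of 1/q, which avoids any distinction by the parity of N.

-- A ring solver with integer coefficients for an arbitrary commutative ring.

module RingSolver {c ℓ : Level} (R : CommutativeRing c ℓ) where
  open CommutativeRing R
  open import Algebra.Solver.Ring.AlmostCommutativeRing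
  open import Algebra.Properties.Ring ring
    using (-‿distribˡ-*; -‿distribʳ-*; -‿involutive; -0#≈0#; -‿+-comm)
  open import Algebra.Properties.Semiring.Mult.TCOptimised semiring
  open import Relation.Binary.Reasoning.Setoid setoid

  private
    -- The solver must decide equality of coefficients. This is possible in ℤ but not in a general
    -- `R`, so the numerals of `R` are reached through this homomorphism.
    fromℤ : ℤ → Carrier
    fromℤ (+ n)    = n × 1#
    fromℤ -[1+ n ] = - (suc n × 1#)

    fromℤ-neg : ∀ i → fromℤ (ℤ.- i) ≈ - fromℤ i
    fromℤ-neg (+ zero)  = sym -0#≈0#
    fromℤ-neg (+ suc n) = refl
    fromℤ-neg -[1+ n ]  = sym (-‿involutive _)

    cancel : ∀ a b c → (a + b) + - (a + c) ≈ b + - c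
    cancel a b c = begin
      (a + b) + - (a + c)     ≈⟨ +-cong (+-comm b a) (-‿+-comm a c) ⟨
      (b + a) + (- a + - c)   ≈⟨ +-assoc b a _ ⟩
      b + (a + (- a + - c))   ≈⟨ +-congˡ (+-assoc a (- a) (- c)) ⟨
      b + ((a + - a) + - c)   ≈⟨ +-congˡ (+-congʳ (-‿inverseʳ a)) ⟩
      b + (0# + - c)          ≈⟨ +-congˡ (+-identityˡ _) ⟩
      b + - c                 ∎

    fromℤ-⊖ : ∀ m n → fromℤ (m ℤ.⊖ n) ≈ m × 1# + - (n × 1#)
    fromℤ-⊖ zero zero = sym (-‿inverseʳ 0#)
    fromℤ-⊖ zero (suc n) = sym (+-identityˡ _)
    fromℤ-⊖ (suc m) zero = sym (trans (+-congˡ -0#≈0#) (+-identityʳ _))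
    fromℤ-⊖ (suc m) (suc n) = begin
      fromℤ (suc m ℤ.⊖ suc n)               ≡⟨ ≡.cong fromℤ (ℤ.[1+m]⊖[1+n]≡m⊖n m n) ⟩
      fromℤ (m ℤ.⊖ n)                       ≈⟨ fromℤ-⊖ m n ⟩
      m × 1# + - (n × 1#)                   ≈⟨ cancel 1# _ _ ⟨
      (1# + m × 1#) + - (1# + n × 1#)       ≈⟨ +-cong (1+× m 1#) (-‿cong (1+× n 1#)) ⟨
      suc m × 1# + - (suc n × 1#)           ∎

    fromℤ-+ : ∀ i j → fromℤ (i ℤ.+ j) ≈ fromℤ i + fromℤ j
    fromℤ-+ (+ m) (+ n) = ×-homo-+ 1# m n
    fromℤ-+ (+ m) -[1+ n ] = fromℤ-⊖ m (suc n)
    fromℤ-+ -[1+ m ] (+ n) = trans (fromℤ-⊖ n (suc m)) (+-comm _ _)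
    fromℤ-+ -[1+ m ] -[1+ n ] = begin
      - (suc (suc (m ℕ.+ n)) × 1#)         ≡⟨ ≡.cong (λ z → - (z × 1#)) (≡.sym (ℕ.+-suc (suc m) n)) ⟩
      - ((suc m ℕ.+ suc n) × 1#)           ≈⟨ -‿cong (×-homo-+ 1# (suc m) (suc n)) ⟩
      - (suc m × 1# + suc n × 1#)          ≈⟨ -‿+-comm _ _ ⟨
      - (suc m × 1#) + - (suc n × 1#)      ∎

    fromℤ-*⁺ : ∀ m j → fromℤ (+ m ℤ.* j) ≈ (m × 1#) * fromℤ j
    fromℤ-*⁺ m (+ n) = begin
      fromℤ (+ m ℤ.* + n)      ≡⟨ ≡.cong fromℤ (≡.sym (ℤ.pos-* m n)) ⟩
      (m ℕ.* n) × 1#           ≈⟨ ×1-homo-* m n ⟩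
      (m × 1#) * (n × 1#)      ∎
    fromℤ-*⁺ m -[1+ n ] = begin
      fromℤ (+ m ℤ.* -[1+ n ])          ≡⟨ ≡.cong fromℤ (≡.sym (ℤ.neg-distribʳ-* (+ m) (+ suc n))) ⟩
      fromℤ (ℤ.- (+ m ℤ.* + suc n))     ≈⟨ fromℤ-neg (+ m ℤ.* + suc n) ⟩
      - fromℤ (+ m ℤ.* + suc n)         ≈⟨ -‿cong (fromℤ-*⁺ m (+ suc n)) ⟩
      - ((m × 1#) * (suc n × 1#))       ≈⟨ -‿distribʳ-* _ _ ⟩
      (m × 1#) * - (suc n × 1#)         ∎

    fromℤ-* : ∀ i j → fromℤ (i ℤ.* j) ≈ fromℤ i * fromℤ j
    fromℤ-* (+ m) j = fromℤ-*⁺ m j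
    fromℤ-* -[1+ m ] j = begin
      fromℤ (-[1+ m ] ℤ.* j)         ≡⟨ ≡.cong fromℤ (≡.sym (ℤ.neg-distribˡ-* (+ suc m) j)) ⟩
      fromℤ (ℤ.- (+ suc m ℤ.* j))    ≈⟨ fromℤ-neg (+ suc m ℤ.* j) ⟩
      - fromℤ (+ suc m ℤ.* j)        ≈⟨ -‿cong (fromℤ-*⁺ (suc m) j) ⟩
      - ((suc m × 1#) * fromℤ j)     ≈⟨ -‿distribˡ-* _ _ ⟩
      - (suc m × 1#) * fromℤ j       ∎

    morphism : ℤ.+-*-rawRing -Raw-AlmostCommutative⟶ fromCommutativeRing R
    morphism = record
      { ⟦_⟧    = fromℤ
      ; +-homo = fromℤ-+
      ; *-homo = fromℤ-*
      ; -‿homo = fromℤ-neg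
      ; 0-homo = refl
      ; 1-homo = refl
      }

    _coeff≟_ : ∀ i j → Maybe (fromℤ i ≈ fromℤ j)
    i coeff≟ j with i ℤ.≟ j
    ... | yes i≡j = just (reflexive (≡.cong fromℤ i≡j))
    ... | no _    = nothing

  open import Algebra.Solver.Ring ℤ.+-*-rawRing (fromCommutativeRing R) morphism _coeff≟_ public
    using (Polynomial; solve; _:=_; _:+_; _:*_; :-_; _:-_; con)

  :1 : ∀ {n} → Polynomial n
  :1 = con (+ 1)

  :0 : ∀ {n} → Polynomial n
  :0 = con (+ 0)

-- Finite sums and products, powers, signs, and proof by linear combination.

module Sums {c ℓ : Level} (R : CommutativeRing c ℓ) where
  open CommutativeRing R
  open Over R
  open RingSolver R
  open import Relation.Binary.Reasoning.Setoid setoid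

  sumTo-cong< : ∀ n {f g} → (∀ i → i < n → f i ≈ g i) → sumTo n f ≈ sumTo n g
  sumTo-cong< zero    h = refl
  sumTo-cong< (suc n) h =
    +-cong (sumTo-cong< n (λ i i<n → h i (ℕ.m<n⇒m<1+n i<n))) (h n ℕ.≤-refl)

  sumTo-cong : ∀ n {f g} → (∀ i → f i ≈ g i) → sumTo n f ≈ sumTo n g
  sumTo-cong n h = sumTo-cong< n (λ i _ → h i)

  sumTo-zero : ∀ n {f} → (∀ i → i < n → f i ≈ 0#) → sumTo n f ≈ 0#
  sumTo-zero zero    h = refl
  sumTo-zero (suc n) h =
    trans (+-cong (sumTo-zero n (λ i i<n → h i (ℕ.m<n⇒m<1+n i<n))) (h n ℕ.≤-refl)) (+-identityʳ 0#)

  sumTo-*ˡ : ∀ n a f → sumTo n (λ i → a * f i) ≈ a * sumTo n f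
  sumTo-*ˡ zero    a f = sym (zeroʳ a)
  sumTo-*ˡ (suc n) a f = trans (+-congʳ (sumTo-*ˡ n a f)) (sym (distribˡ a _ _))

  sumTo-+ : ∀ n f g → sumTo n (λ i → f i + g i) ≈ sumTo n f + sumTo n g
  sumTo-+ zero    f g = sym (+-identityʳ 0#)
  sumTo-+ (suc n) f g = trans (+-congʳ (sumTo-+ n f g))
    (solve 4 (λ a b x y → (a :+ b) :+ (x :+ y) := (a :+ x) :+ (b :+ y)) refl _ _ _ _)

  sumTo-neg : ∀ n f → sumTo n (λ i → - f i) ≈ - sumTo n f
  sumTo-neg zero    f = solve 0 (:0 := :- :0) refl
  sumTo-neg (suc n) f = trans (+-congʳ (sumTo-neg n f))
    (solve 2 (λ a b → :- a :+ :- b := :- (a :+ b)) refl _ _)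

  sumTo-swap : ∀ m n (f : ℕ → ℕ → Carrier) →
    sumTo m (λ i → sumTo n (f i)) ≈ sumTo n (λ j → sumTo m (λ i → f i j))
  sumTo-swap zero    n f = sym (sumTo-zero n (λ _ _ → refl))
  sumTo-swap (suc m) n f = trans (+-congʳ (sumTo-swap m n f)) (sym (sumTo-+ n _ _))

  sumTo-split : ∀ m n f → sumTo (m ℕ.+ n) f ≈ sumTo m f + sumTo n (λ i → f (m ℕ.+ i))
  sumTo-split m zero f rewrite ℕ.+-identityʳ m = sym (+-identityʳ _)
  sumTo-split m (suc n) f rewrite ℕ.+-suc m n =
    trans (+-congʳ (sumTo-split m n f)) (+-assoc _ _ _)

  sumTo-suc : ∀ n f → sumTo (suc n) f ≈ f 0 + sumTo n (λ i → f (suc i))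
  sumTo-suc n f = trans (sumTo-split 1 n f) (+-congʳ (+-identityˡ _))

  sumTo-reverse : ∀ n f → sumTo (suc n) f ≈ sumTo (suc n) (λ i → f (n ℕ.∸ i))
  sumTo-reverse zero    f = refl
  sumTo-reverse (suc n) f = begin
    sumTo (suc n) f + f (suc n)                         ≈⟨ +-congʳ (sumTo-reverse n f) ⟩
    sumTo (suc n) (λ i → f (n ℕ.∸ i)) + f (suc n)       ≈⟨ +-comm _ _ ⟩
    f (suc n) + sumTo (suc n) (λ i → f (n ℕ.∸ i))       ≈⟨ sumTo-suc (suc n) (λ i → f (suc n ℕ.∸ i)) ⟨
    sumTo (suc (suc n)) (λ i → f (suc n ℕ.∸ i))         ∎

  prodTo-cong : ∀ n {f g} → (∀ i → f i ≈ g i) → prodTo n f ≈ prodTo n g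
  prodTo-cong zero    h = refl
  prodTo-cong (suc n) h = *-cong (prodTo-cong n h) (h n)

  prodTo-split : ∀ m n f → prodTo (m ℕ.+ n) f ≈ prodTo m f * prodTo n (λ i → f (m ℕ.+ i))
  prodTo-split m zero f rewrite ℕ.+-identityʳ m = sym (*-identityʳ _)
  prodTo-split m (suc n) f rewrite ℕ.+-suc m n =
    trans (*-congʳ (prodTo-split m n f)) (*-assoc _ _ _)

  pow-+ : ∀ x m n → pow x (m ℕ.+ n) ≈ pow x m * pow x n
  pow-+ x zero    n = sym (*-identityˡ _)
  pow-+ x (suc m) n = trans (*-congˡ (pow-+ x m n)) (sym (*-assoc _ _ _))

  pow-≡ : ∀ x {m n} → m ≡ n → pow x m ≈ pow x n
  pow-≡ x m≡n = reflexive (≡.cong (pow x) m≡n)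

  pow-inverse : ∀ {x y} → x * y ≈ 1# → ∀ n → pow x n * pow y n ≈ 1#
  pow-inverse xy zero    = *-identityʳ 1#
  pow-inverse {x} {y} xy (suc n) = begin
    (x * pow x n) * (y * pow y n)
      ≈⟨ solve 4 (λ a b c d → (a :* b) :* (c :* d) := (a :* c) :* (b :* d)) refl _ _ _ _ ⟩
    (x * y) * (pow x n * pow y n)   ≈⟨ *-cong xy (pow-inverse xy n) ⟩
    1# * 1#                         ≈⟨ *-identityʳ 1# ⟩
    1#                              ∎

  pow-unit : ∀ {x} → ∀ m n → pow x m ≈ 1# → pow x (m ℕ.* n) ≈ 1#
  pow-unit {x} m zero    h = pow-≡ x (ℕ.*-zeroʳ m)
  pow-unit {x} m (suc n) h = begin
    pow x (m ℕ.* suc n)             ≡⟨ ≡.cong (pow x) (ℕ.*-suc m n) ⟩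
    pow x (m ℕ.+ m ℕ.* n)           ≈⟨ pow-+ x m _ ⟩
    pow x m * pow x (m ℕ.* n)       ≈⟨ *-cong h (pow-unit m n h) ⟩
    1# * 1#                         ≈⟨ *-identityʳ 1# ⟩
    1#                              ∎

  unit-cancel : ∀ {x y a b} → y * x ≈ 1# → x * a ≈ x * b → a ≈ b
  unit-cancel {x} {y} {a} {b} yx h = begin
    a             ≈⟨ *-identityˡ a ⟨
    1# * a        ≈⟨ *-congʳ yx ⟨
    (y * x) * a   ≈⟨ *-assoc y x a ⟩
    y * (x * a)   ≈⟨ *-congˡ h ⟩
    y * (x * b)   ≈⟨ *-assoc y x b ⟨
    (y * x) * b   ≈⟨ *-congʳ yx ⟩
    1# * b        ≈⟨ *-identityˡ b ⟩
    b             ∎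

  signPow-* : ∀ n x → signPow n x ≈ signPow n 1# * x
  signPow-* zero    x = sym (*-identityˡ x)
  signPow-* (suc n) x = trans (-‿cong (signPow-* n x))
    (solve 2 (λ a b → :- (a :* b) := :- a :* b) refl _ _)

  signPow-+ : ∀ m n → signPow (m ℕ.+ n) 1# ≈ signPow m 1# * signPow n 1#
  signPow-+ zero    n = sym (*-identityˡ _)
  signPow-+ (suc m) n = trans (-‿cong (signPow-+ m n))
    (solve 2 (λ a b → :- (a :* b) := :- a :* b) refl _ _)

  signPow-square : ∀ n → signPow n 1# * signPow n 1# ≈ 1#
  signPow-square zero    = *-identityʳ 1#
  signPow-square (suc n) =
    trans (solve 1 (λ a → :- a :* :- a := a :* a) refl _) (signPow-square n)

  -- A linear combination of hypotheses l ≈ r proves x ≈ y; the remaining polynomial identity is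
  -- left to the ring solver.
  linear₁ : ∀ {x y c l r} → l ≈ r → x + c * r ≈ y + c * l → x ≈ y
  linear₁ {x} {y} {c} {l} {r} l≈r h = begin
    x                       ≈⟨ solve 2 (λ x a → x := (x :+ a) :- a) refl x (c * r) ⟩
    (x + c * r) - c * r     ≈⟨ +-cong h (-‿cong (*-congˡ (sym l≈r))) ⟩
    (y + c * l) - c * l     ≈⟨ solve 2 (λ x a → (x :+ a) :- a := x) refl y (c * l) ⟩
    y                       ∎

  linear₂ : ∀ {x y c l r d s t} → l ≈ r → s ≈ t →
            (x + c * r) + d * t ≈ (y + c * l) + d * s → x ≈ y
  linear₂ l≈r s≈t h = linear₁ l≈r (linear₁ s≈t h)

  linear₃ : ∀ {x y c l r d s t e v w} → l ≈ r → s ≈ t → v ≈ w →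
            ((x + c * r) + d * t) + e * w ≈ ((y + c * l) + d * s) + e * v → x ≈ y
  linear₃ l≈r s≈t v≈w h = linear₁ l≈r (linear₂ s≈t v≈w h)

  linear₄ : ∀ {x y c l r d s t e v w f j k} → l ≈ r → s ≈ t → v ≈ w → j ≈ k →
            (((x + c * r) + d * t) + e * w) + f * k ≈ (((y + c * l) + d * s) + e * v) + f * j → x ≈ y
  linear₄ l≈r s≈t v≈w j≈k h = linear₁ l≈r (linear₃ s≈t v≈w j≈k h)

IsInverse : ∀ {c ℓ} (R : CommutativeRing c ℓ) → let open CommutativeRing R in Carrier → Carrier → Set ℓ
IsInverse R x y = let open CommutativeRing R in x * y ≈ 1#

-- Gaussian binomials and shifted factorials.

module QBinomial {c ℓ : Level} (R : CommutativeRing c ℓ)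
  (q u : CommutativeRing.Carrier R) (qu : IsInverse R q u) where

  open CommutativeRing R hiding (zero)
  open Over R
  open RingSolver R
  open Sums R
  open import Relation.Binary.Reasoning.Setoid setoid

  qbin-zero : ∀ {n k} → n < k → qbin q n k ≈ 0#
  qbin-zero {zero}  {suc k} _ = refl
  qbin-zero {suc n} {suc k} (s≤s n<k) = begin
    qbin q n k + pow q (suc k) * qbin q n (suc k)
      ≈⟨ +-cong (qbin-zero n<k) (*-congˡ (qbin-zero (ℕ.m<n⇒m<1+n n<k))) ⟩
    0# + pow q (suc k) * 0#      ≈⟨ +-identityˡ _ ⟩
    pow q (suc k) * 0#           ≈⟨ zeroʳ _ ⟩
    0#                           ∎

  qbin-diag : ∀ n → qbin q n n ≈ 1#
  qbin-diag zero    = refl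
  qbin-diag (suc n) = begin
    qbin q n n + pow q (suc n) * qbin q n (suc n)
      ≈⟨ +-cong (qbin-diag n) (*-congˡ (qbin-zero (ℕ.n<1+n n))) ⟩
    1# + pow q (suc n) * 0#   ≈⟨ +-congˡ (zeroʳ _) ⟩
    1# + 0#                   ≈⟨ +-identityʳ 1# ⟩
    1#                        ∎

  -- Stated with u = 1/q, so that no truncated subtraction occurs and n < k needs no exception.
  qbin-absorbʳ : ∀ n k → (1# - pow q n * pow u k) * qbin q n k ≈ (1# - pow q (suc k)) * qbin q n (suc k)
  qbin-absorbʳ zero zero =
    solve 1 (λ q → (:1 :- :1 :* :1) :* :1 := (:1 :- q :* :1) :* :0) refl q
  qbin-absorbʳ zero (suc k) = trans (zeroʳ _) (sym (zeroʳ _))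
  qbin-absorbʳ (suc n) zero = linear₁ (qbin-absorbʳ n zero)
    (solve 3 (λ q Q b →
         (:1 :- (q :* Q) :* :1) :* :1 :+ q :* ((:1 :- q :* :1) :* b)
      := (:1 :- q :* :1) :* (:1 :+ (q :* :1) :* b) :+ q :* ((:1 :- Q :* :1) :* :1)) refl
      q (pow q n) (qbin q n 1))
  qbin-absorbʳ (suc n) (suc k) =
    linear₃ (qbin-absorbʳ n k) (qbin-absorbʳ n (suc k)) qu
    (solve 8 (λ q u Q K U a b c →
         (((:1 :- (q :* Q) :* (u :* U)) :* (a :+ (q :* K) :* b)
            :+ :1 :* ((:1 :- q :* K) :* b))
            :+ (q :* q :* K) :* ((:1 :- q :* (q :* K)) :* c))
            :+ (:- (Q :* U :* a)) :* :1
      := (((:1 :- q :* (q :* K)) :* (b :+ (q :* (q :* K)) :* c)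
            :+ :1 :* ((:1 :- Q :* U) :* a))
            :+ (q :* q :* K) :* ((:1 :- Q :* (u :* U)) :* b))
            :+ (:- (Q :* U :* a)) :* (q :* u)) refl
      q u (pow q n) (pow q k) (pow u k) (qbin q n k) (qbin q n (suc k)) (qbin q n (suc (suc k))))

  qbin-absorb : ∀ n k → (1# - pow q (suc k)) * qbin q (suc n) (suc k) ≈ (1# - pow q (suc n)) * qbin q n k
  qbin-absorb n k = linear₂ (pow-inverse qu k) (qbin-absorbʳ n k)
    (solve 6 (λ q Q K U a b →
         ((:1 :- q :* K) :* (a :+ (q :* K) :* b)
            :+ (:- (q :* Q :* a)) :* :1)
            :+ (:- (q :* K)) :* ((:1 :- q :* K) :* b)
      := ((:1 :- q :* Q) :* a
            :+ (:- (q :* Q :* a)) :* (K :* U))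
            :+ (:- (q :* K)) :* ((:1 :- Q :* U) :* a)) refl
      q (pow q n) (pow q k) (pow u k) (qbin q n k) (qbin q n (suc k)))

  qbin-absorbˡ : ∀ n k → (1# - pow q (suc n) * pow u k) * qbin q (suc n) k ≈ (1# - pow q (suc n)) * qbin q n k
  qbin-absorbˡ n k = trans (qbin-absorbʳ (suc n) k) (qbin-absorb n k)

  -- The product (q^i; q)_n, with its base recorded by the exponent i: splitting and joining such
  -- products is then arithmetic of natural numbers.
  pochPow : ℕ → ℕ → Carrier
  pochPow i n = poch q (pow q i) n

  -- The substitute for dividing by (q)_n. For a primitive N-th root of unity it stops at n < N
  -- because (q)_N is zero.
  Cancellable : ℕ → Set (c ⊔ ℓ)
  Cancellable N = ∀ n → n < N → ∀ {x y} → pochPow 1 n * x ≈ pochPow 1 n * y → x ≈ y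

  pochPow-≡ : ∀ {i j m n} → i ≡ j → m ≡ n → pochPow i m ≈ pochPow j n
  pochPow-≡ i≡j m≡n = reflexive (≡.cong₂ pochPow i≡j m≡n)

  pochPow-split : ∀ i m n → pochPow i (m ℕ.+ n) ≈ pochPow i m * pochPow (i ℕ.+ m) n
  pochPow-split i m n = trans (prodTo-split m n _) (*-congˡ (prodTo-cong n λ t →
    +-congˡ (-‿cong (begin
      pow q i * pow q (m ℕ.+ t)        ≈⟨ *-congˡ (pow-+ q m t) ⟩
      pow q i * (pow q m * pow q t)    ≈⟨ *-assoc _ _ _ ⟨
      (pow q i * pow q m) * pow q t    ≈⟨ *-congʳ (pow-+ q i m) ⟨
      pow q (i ℕ.+ m) * pow q t        ∎))))

  pochPow-suc : ∀ i n → pochPow i (suc n) ≈ (1# - pow q i) * pochPow (suc i) n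
  pochPow-suc i zero =
    solve 1 (λ a → :1 :* (:1 :- a :* :1) := (:1 :- a) :* :1) refl (pow q i)
  pochPow-suc i (suc n) = trans (*-congʳ (pochPow-suc i n))
    (solve 4 (λ q a b p → ((:1 :- a) :* p) :* (:1 :- a :* (q :* b))
                       := (:1 :- a) :* (p :* (:1 :- (q :* a) :* b))) refl
      q (pow q i) (pow q n) (pochPow (suc i) n))

  qbin-pochʳ : ∀ a k → qbin q (a ℕ.+ k) k * pochPow 1 k ≈ pochPow (suc a) k
  qbin-pochʳ a zero    = *-identityʳ 1#
  qbin-pochʳ a (suc k) rewrite ℕ.+-suc a k =
    linear₃ (qbin-absorb (a ℕ.+ k) k) (qbin-pochʳ a k) (pow-+ q a k)
    (solve 8 (λ q A K S x y p r →
         ((x :* (p :* (:1 :- (q :* :1) :* K))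
            :+ p :* ((:1 :- q :* S) :* y))
            :+ (:1 :- q :* S) :* r)
            :+ (:- (q :* r)) :* (A :* K)
      := ((r :* (:1 :- (q :* A) :* K)
            :+ p :* ((:1 :- q :* K) :* x))
            :+ (:1 :- q :* S) :* (y :* p))
            :+ (:- (q :* r)) :* S) refl
      q (pow q a) (pow q k) (pow q (a ℕ.+ k)) (qbin q (suc (a ℕ.+ k)) (suc k)) (qbin q (a ℕ.+ k) k)
      (pochPow 1 k) (pochPow (suc a) k))

  -- The q-Pascal recursion is not symmetric in its two lower indices, so the complementary index
  -- needs an induction of its own. Together with `qbin-pochʳ` this is the symmetry of the Gaussian
  -- binomial, up to a factor (q)_k.
  qbin-pochˡ : ∀ a k → qbin q (a ℕ.+ k) a * pochPow 1 k ≈ pochPow (suc a) k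
  qbin-pochˡ a zero = begin
    qbin q (a ℕ.+ 0) a * 1#   ≈⟨ *-identityʳ _ ⟩
    qbin q (a ℕ.+ 0) a        ≡⟨ ≡.cong (λ n → qbin q n a) (ℕ.+-identityʳ a) ⟩
    qbin q a a                ≈⟨ qbin-diag a ⟩
    1#                        ∎
  qbin-pochˡ a (suc k) rewrite ℕ.+-suc a k =
    linear₄ (qbin-absorbˡ (a ℕ.+ k) a) (qbin-pochˡ a k) (pow-+ q a k) (pow-inverse qu a)
    (solve 9 (λ q A K S U x y p r →
         (((x :* (p :* (:1 :- (q :* :1) :* K))
            :+ p :* ((:1 :- q :* S) :* y))
            :+ (:1 :- q :* S) :* r)
            :+ (x :* p :* q :* U :- q :* r) :* (A :* K))
            :+ (x :* p :* q :* K) :* :1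
      := (((r :* (:1 :- (q :* A) :* K)
            :+ p :* ((:1 :- (q :* S) :* U) :* x))
            :+ (:1 :- q :* S) :* (y :* p))
            :+ (x :* p :* q :* U :- q :* r) :* S)
            :+ (x :* p :* q :* K) :* (A :* U)) refl
      q (pow q a) (pow q k) (pow q (a ℕ.+ k)) (pow u a) (qbin q (suc (a ℕ.+ k)) a) (qbin q (a ℕ.+ k) a)
      (pochPow 1 k) (pochPow (suc a) k))

  private
    term : ℕ → ℕ → ℕ → Carrier
    term M c r = pow q (r ℕ.* r ℕ.+ r ℕ.* c) * qbin q M r * pochPow (suc (c ℕ.+ r)) (M ℕ.∸ r)

    shifted : ℕ → ℕ → ℕ → Carrier
    shifted M c r = pow q (suc (c ℕ.+ r)) * term M (suc c) r

    exponent₁ : ∀ r c → suc r ℕ.* suc r ℕ.+ suc r ℕ.* c ≡ suc (c ℕ.+ r) ℕ.+ (r ℕ.* r ℕ.+ r ℕ.* suc c)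
    exponent₁ = ℕSolver.solve-∀

    exponent₂ : ∀ r c → (suc r ℕ.* suc r ℕ.+ suc r ℕ.* c) ℕ.+ suc r ≡ suc r ℕ.* suc r ℕ.+ suc r ℕ.* suc c
    exponent₂ = ℕSolver.solve-∀

    term-suc-0 : ∀ M c → term (suc M) c 0 ≈ term M (suc c) 0 - shifted M c 0
    term-suc-0 M c = begin
      1# * 1# * pochPow (suc (c ℕ.+ 0)) (suc M)
        ≈⟨ *-congˡ (pochPow-suc (suc (c ℕ.+ 0)) M) ⟩
      1# * 1# * ((1# - pow q (suc (c ℕ.+ 0))) * pochPow (suc (suc c ℕ.+ 0)) M)
        ≈⟨ solve 2 (λ a p → :1 :* :1 :* ((:1 :- a) :* p)
                         := :1 :* :1 :* p :- a :* (:1 :* :1 :* p)) refl _ _ ⟩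
      term M (suc c) 0 - shifted M c 0  ∎

    -- The q-Pascal rule splits the binomial. Its first part is `shifted M c r`; in its second part
    -- the leading factor 1 - q^(c+r+2) of the product is detached, which raises c by one and leaves
    -- `shifted` at r+1 behind. Summed over r, the `shifted` terms telescope.
    term-suc-suc : ∀ M c r →
      term (suc M) c (suc r) ≈ (term M (suc c) (suc r) - shifted M c (suc r)) + shifted M c r
    term-suc-suc M c r = begin
      E * (a + Q * b) * P
        ≈⟨ solve 5 (λ E a Q b P → E :* (a :+ Q :* b) :* P := (E :* Q) :* (b :* P) :+ E :* a :* P)
             refl E a Q b P ⟩
      (E * Q) * (b * P) + E * a * P
        ≈⟨ +-cong (*-cong eEQ bP) (*-cong (*-congʳ eE) eP) ⟩
      E′ * (b * ((1# - W) * P′)) + (pow q (suc (c ℕ.+ r)) * pow q (r ℕ.* r ℕ.+ r ℕ.* suc c)) * a * P″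
        ≈⟨ solve 8 (λ E′ b W P′ V F a P″ →
                E′ :* (b :* ((:1 :- W) :* P′)) :+ (V :* F) :* a :* P″
             := (E′ :* b :* P′ :- W :* (E′ :* b :* P′)) :+ V :* (F :* a :* P″))
             refl E′ b W P′ _ _ a P″ ⟩
      (term M (suc c) (suc r) - shifted M c (suc r)) + shifted M c r ∎
      where
      E = pow q (suc r ℕ.* suc r ℕ.+ suc r ℕ.* c)
      E′ = pow q (suc r ℕ.* suc r ℕ.+ suc r ℕ.* suc c)
      a = qbin q M r
      b = qbin q M (suc r)
      Q = pow q (suc r)
      W = pow q (suc (c ℕ.+ suc r))
      P = pochPow (suc (c ℕ.+ suc r)) (M ℕ.∸ r)
      P′ = pochPow (suc (suc c ℕ.+ suc r)) (M ℕ.∸ suc r)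
      P″ = pochPow (suc (suc c ℕ.+ r)) (M ℕ.∸ r)

      eE : E ≈ pow q (suc (c ℕ.+ r)) * pow q (r ℕ.* r ℕ.+ r ℕ.* suc c)
      eE = trans (pow-≡ q (exponent₁ r c)) (pow-+ q (suc (c ℕ.+ r)) _)

      eEQ : E * Q ≈ E′
      eEQ = trans (sym (pow-+ q (suc r ℕ.* suc r ℕ.+ suc r ℕ.* c) (suc r))) (pow-≡ q (exponent₂ r c))

      eP : P ≈ P″
      eP = pochPow-≡ {n = M ℕ.∸ r} (≡.cong suc (ℕ.+-suc c r)) ≡.refl

      -- A factor can be detached only if M ∸ r is positive. For r >= M the equation survives
      -- because `b` is zero.
      bP : b * P ≈ b * ((1# - W) * P′)
      bP with r ℕ.<? M
      ... | yes r<M = *-congˡ (trans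
              (pochPow-≡ {i = suc (c ℕ.+ suc r)} ≡.refl (ℕ.+-∸-assoc 1 r<M))
              (pochPow-suc (suc (c ℕ.+ suc r)) (M ℕ.∸ suc r)))
      ... | no r≮M = trans (*-congʳ b0) (trans (zeroˡ _) (sym (trans (*-congʳ b0) (zeroˡ _))))
        where b0 = qbin-zero (s≤s (ℕ.≮⇒≥ r≮M))

    sum-term-suc : ∀ M c R →
      sumTo (suc R) (term (suc M) c) ≈ sumTo (suc R) (term M (suc c)) - shifted M c R
    sum-term-suc M c zero = trans (+-congˡ (term-suc-0 M c)) (sym (+-assoc _ _ _))
    sum-term-suc M c (suc R) = trans (+-cong (sum-term-suc M c R) (term-suc-suc M c R))
      (solve 4 (λ s d t e → (s :- d) :+ ((t :- e) :+ d) := (s :+ t) :- e) refl _ _ _ _)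

  -- The finite Durfee rectangle identity, a limiting case of q-Chu-Vandermonde: Σ_r q^(r²+rc)
  -- [M choose r] / (q^(c+1))_r = 1 / (q^(c+1))_M, multiplied by (q^(c+1))_M. The induction on M
  -- lets c vary, since each step passes from c to c+1.
  sum-qbin-poch : ∀ M c →
    sumTo (suc M) (λ r → pow q (r ℕ.* r ℕ.+ r ℕ.* c) * qbin q M r * pochPow (suc (c ℕ.+ r)) (M ℕ.∸ r)) ≈ 1#
  sum-qbin-poch zero c = solve 0 (:0 :+ :1 :* :1 :* :1 := :1) refl
  sum-qbin-poch (suc M) c = begin
    sumTo (suc (suc M)) (term (suc M) c)
      ≈⟨ sum-term-suc M c (suc M) ⟩
    (sumTo (suc M) (term M (suc c)) + term M (suc c) (suc M)) - shifted M c (suc M)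
      ≈⟨ +-cong (+-cong (sum-qbin-poch M (suc c)) term-zero) (-‿cong (trans (*-congˡ term-zero) (zeroʳ _))) ⟩
    (1# + 0#) - 0#
      ≈⟨ solve 0 ((:1 :+ :0) :- :0 := :1) refl ⟩
    1# ∎
    where
    term-zero : term M (suc c) (suc M) ≈ 0#
    term-zero = trans (*-congʳ (trans (*-congˡ (qbin-zero (ℕ.n<1+n M))) (zeroʳ _))) (zeroˡ _)

-- Alternating antidiagonal sums of Gaussian binomials, later applied with `q` and `u` exchanged.

choose₂ : ℕ → ℕ
choose₂ zero    = 0
choose₂ (suc n) = choose₂ n ℕ.+ n

module Alternating {c ℓ : Level} (R : CommutativeRing c ℓ)
  (q u : CommutativeRing.Carrier R) (qu : IsInverse R q u) where

  open CommutativeRing R hiding (zero)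
  open Over R
  open RingSolver R
  open Sums R
  open QBinomial R q u qu
  open import Relation.Binary.Reasoning.Setoid setoid

  -- The second q-Pascal rule, with q^(n-k) written as q^n u^k. Its difference from the defining
  -- rule is exactly `qbin-absorbʳ`.
  qbin-pascal : ∀ n k → qbin q (suc n) (suc k) ≈ qbin q n (suc k) + (pow q n * pow u k) * qbin q n k
  qbin-pascal n k = linear₁ (qbin-absorbʳ n k)
    (solve 4 (λ a b Q P → (a :+ Q :* b) :+ :1 :* ((:1 :- Q) :* b)
                       := (b :+ P :* a) :+ :1 :* ((:1 :- P) :* a)) refl
      (qbin q n k) (qbin q n (suc k)) (pow q (suc k)) (pow q n * pow u k))

  private
    antidiag : ℕ → ℕ → Carrier
    antidiag n j = qbin q (n ℕ.∸ j) j

    antidiag-zero : ∀ n j → n < j ℕ.+ j → antidiag n j ≈ 0#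
    antidiag-zero n (suc j) n<2j = qbin-zero (ℕ.m<n+o⇒m∸n<o n (suc j) n<2j)

    antidiag-zero₀ : ∀ n j → n < j → antidiag n j ≈ 0#
    antidiag-zero₀ n j n<j = antidiag-zero n j (ℕ.<-≤-trans n<j (ℕ.m≤m+n j j))

    antidiag-zero₂ : ∀ n j → n < j → antidiag (suc (suc n)) (suc j) ≈ 0#
    antidiag-zero₂ n j n<j = antidiag-zero (suc (suc n)) (suc j)
      (s≤s (≡.subst (suc n <_) (≡.sym (ℕ.+-suc j j)) (s≤s (ℕ.<-≤-trans n<j (ℕ.m≤m+n j j)))))

    -- For j > n the subtractions may truncate, but then all three entries are zero.
    antidiag-pascal₁ : ∀ n j →
      antidiag (suc (suc n)) (suc j) ≈ antidiag n j + pow q (suc j) * antidiag (suc n) (suc j)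
    antidiag-pascal₁ n j with j ℕ.≤? n
    ... | yes j≤n = reflexive (≡.cong (λ m → qbin q m (suc j)) (ℕ.+-∸-assoc 1 j≤n))
    ... | no j≰n = begin
      antidiag (suc (suc n)) (suc j)   ≈⟨ antidiag-zero₂ n j n<j ⟩
      0#                               ≈⟨ solve 1 (λ a → :0 := :0 :+ a :* :0) refl _ ⟩
      0# + pow q (suc j) * 0#          ≈⟨ +-cong (antidiag-zero₀ n j n<j) (*-congˡ (antidiag-zero₀ (suc n) (suc j) (s≤s n<j))) ⟨
      antidiag n j + pow q (suc j) * antidiag (suc n) (suc j) ∎
      where n<j = ℕ.≰⇒> j≰n

    antidiag-pascal₂ : ∀ n j →
      antidiag (suc (suc n)) (suc j) ≈ antidiag (suc n) (suc j) + (pow q n * pow u j * pow u j) * antidiag n j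
    antidiag-pascal₂ n j with j ℕ.≤? n
    ... | yes j≤n = begin
      qbin q (suc n ℕ.∸ j) (suc j)     ≡⟨ ≡.cong (λ m → qbin q m (suc j)) (ℕ.+-∸-assoc 1 j≤n) ⟩
      qbin q (suc (n ℕ.∸ j)) (suc j)   ≈⟨ qbin-pascal (n ℕ.∸ j) j ⟩
      antidiag (suc n) (suc j) + (pow q (n ℕ.∸ j) * pow u j) * antidiag n j
        ≈⟨ +-congˡ (*-congʳ (*-congʳ q^[n∸j])) ⟩
      antidiag (suc n) (suc j) + (pow q n * pow u j * pow u j) * antidiag n j ∎
      where
      q^[n∸j] : pow q (n ℕ.∸ j) ≈ pow q n * pow u j
      q^[n∸j] = begin
        pow q (n ℕ.∸ j)                          ≈⟨ *-identityʳ _ ⟨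
        pow q (n ℕ.∸ j) * 1#                     ≈⟨ *-congˡ (pow-inverse qu j) ⟨
        pow q (n ℕ.∸ j) * (pow q j * pow u j)    ≈⟨ *-assoc _ _ _ ⟨
        pow q (n ℕ.∸ j) * pow q j * pow u j      ≈⟨ *-congʳ (pow-+ q (n ℕ.∸ j) j) ⟨
        pow q (n ℕ.∸ j ℕ.+ j) * pow u j          ≈⟨ *-congʳ (pow-≡ q (ℕ.m∸n+n≡m j≤n)) ⟩
        pow q n * pow u j                        ∎
    ... | no j≰n = begin
      antidiag (suc (suc n)) (suc j)   ≈⟨ antidiag-zero₂ n j n<j ⟩
      0#                               ≈⟨ solve 1 (λ a → :0 := :0 :+ a :* :0) refl _ ⟩
      0# + (pow q n * pow u j * pow u j) * 0#
        ≈⟨ +-cong (antidiag-zero₀ (suc n) (suc j) (s≤s n<j)) (*-congˡ (antidiag-zero₀ n j n<j)) ⟨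
      antidiag (suc n) (suc j) + (pow q n * pow u j * pow u j) * antidiag n j ∎
      where n<j = ℕ.≰⇒> j≰n

  -- The terms with 2j > n vanish, including those where n ∸ j truncates.
  altSum : ℕ → ℕ → Carrier
  altSum B n = sumTo B (λ j → signPow j 1# * (pow q (choose₂ j) * qbin q (n ℕ.∸ j) j))

  private
    -- The auxiliary sum that `altSum-rec` produces: `antidiag-pascal₂` brings in q^n u^(2j), and
    -- q^C(j+1,2) = q^C(j,2) q^j absorbs only one of the two factors u^j.
    twisted : ℕ → ℕ → Carrier
    twisted B n = sumTo B (λ j → signPow j 1# * (pow q (choose₂ j) * (pow u j * antidiag n j)))

    altSum-rec : ∀ B n → altSum (suc B) (suc (suc n)) ≈ altSum (suc B) (suc n) - pow q n * twisted B n
    altSum-rec B n = begin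
      altSum (suc B) (suc (suc n))    ≈⟨ sumTo-suc B _ ⟩
      z + sumTo B f                   ≈⟨ +-congˡ (sumTo-cong B step) ⟩
      z + sumTo B (λ j → g j + - (pow q n * h j))
        ≈⟨ +-congˡ (trans (sumTo-+ B g _) (+-congˡ (trans (sumTo-neg B _) (-‿cong (sumTo-*ˡ B _ h))))) ⟩
      z + (sumTo B g - pow q n * sumTo B h)   ≈⟨ +-assoc _ _ _ ⟨
      (z + sumTo B g) - pow q n * sumTo B h   ≈⟨ +-congʳ (sumTo-suc B _) ⟨
      altSum (suc B) (suc n) - pow q n * twisted B n ∎
      where
      z = 1# * (1# * 1#)
      f g h : ℕ → Carrier
      f j = signPow (suc j) 1# * (pow q (choose₂ (suc j)) * antidiag (suc (suc n)) (suc j))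
      g j = signPow (suc j) 1# * (pow q (choose₂ (suc j)) * antidiag (suc n) (suc j))
      h j = signPow j 1# * (pow q (choose₂ j) * (pow u j * antidiag n j))

      step : ∀ j → f j ≈ g j + - (pow q n * h j)
      step j = linear₃ (antidiag-pascal₂ n j) (pow-+ q (choose₂ j) j) (pow-inverse qu j)
        (solve 9 (λ s C D J U P a b d →
            (((:- s :* (C :* a)
              :+ (:- s :* C) :* (b :+ (P :* U :* U) :* d))
              :+ (:- s :* P :* U :* U :* d) :* (D :* J))
              :+ (:- s :* P :* U :* d :* D) :* :1)
         := (((:- s :* (C :* b) :+ :- (P :* (s :* (D :* (U :* d)))))
              :+ (:- s :* C) :* a)
              :+ (:- s :* P :* U :* U :* d) :* C)
              :+ (:- s :* P :* U :* d :* D) :* (J :* U)) refl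
          (signPow j 1#) (pow q (choose₂ (suc j))) (pow q (choose₂ j)) (pow q j) (pow u j) (pow q n)
          (antidiag (suc (suc n)) (suc j)) (antidiag (suc n) (suc j)) (antidiag n j))

    -- Here the other Pascal rule is the right one: its factor q^(j+1) cancels the twist u^(j+1) of
    -- the shifted term, while in the remaining part q^C(j+1,2) u^(j+1) is q^C(j,2) u. Both parts
    -- are untwisted again.
    twisted-rec : ∀ B n → twisted (suc B) (suc (suc n)) ≈ altSum (suc B) (suc n) - u * altSum B n
    twisted-rec B n = begin
      twisted (suc B) (suc (suc n))   ≈⟨ sumTo-suc B _ ⟩
      z′ + sumTo B f                  ≈⟨ +-cong (solve 0 (:1 :* (:1 :* (:1 :* :1)) := :1 :* (:1 :* :1)) refl) (sumTo-cong B step) ⟩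
      z + sumTo B (λ j → g j + - (u * h j))
        ≈⟨ +-congˡ (trans (sumTo-+ B g _) (+-congˡ (trans (sumTo-neg B _) (-‿cong (sumTo-*ˡ B _ h))))) ⟩
      z + (sumTo B g - u * sumTo B h)   ≈⟨ +-assoc _ _ _ ⟨
      (z + sumTo B g) - u * sumTo B h   ≈⟨ +-congʳ (sumTo-suc B _) ⟨
      altSum (suc B) (suc n) - u * altSum B n ∎
      where
      z = 1# * (1# * 1#)
      z′ = 1# * (1# * (1# * 1#))
      f g h : ℕ → Carrier
      f j = signPow (suc j) 1# * (pow q (choose₂ (suc j)) * (pow u (suc j) * antidiag (suc (suc n)) (suc j)))
      g j = signPow (suc j) 1# * (pow q (choose₂ (suc j)) * antidiag (suc n) (suc j))
      h j = signPow j 1# * (pow q (choose₂ j) * antidiag n j)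

      step : ∀ j → f j ≈ g j + - (u * h j)
      step j = linear₄ (antidiag-pascal₁ n j) (pow-+ q (choose₂ j) j) (pow-inverse qu j) qu
        (solve 10 (λ s C D J U q u a b d →
            ((((:- s :* (C :* ((u :* U) :* a))
              :+ (:- s :* C :* u :* U) :* (d :+ (q :* J) :* b))
              :+ (:- s :* u :* U :* d) :* (D :* J))
              :+ (:- s :* u :* d :* D :- s :* C :* b :* u :* q) :* :1)
              :+ (:- s :* C :* b) :* :1)
         := ((((:- s :* (C :* b) :+ :- (u :* (s :* (D :* d))))
              :+ (:- s :* C :* u :* U) :* a)
              :+ (:- s :* u :* U :* d) :* C)
              :+ (:- s :* u :* d :* D :- s :* C :* b :* u :* q) :* (J :* U))
              :+ (:- s :* C :* b) :* (q :* u)) refl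
          (signPow j 1#) (pow q (choose₂ (suc j))) (pow q (choose₂ j)) (pow q j) (pow u j) q u
          (antidiag (suc (suc n)) (suc j)) (antidiag (suc n) (suc j)) (antidiag n j))

  altSum-stable : ∀ d B n → n < B ℕ.+ B → altSum (d ℕ.+ B) n ≈ altSum B n
  altSum-stable zero    B n n<2B = refl
  altSum-stable (suc d) B n n<2B = trans
    (+-cong (altSum-stable d B n n<2B) (trans (*-congˡ (trans (*-congˡ vanish) (zeroʳ _))) (zeroʳ _)))
    (+-identityʳ _)
    where
    vanish : antidiag n (d ℕ.+ B) ≈ 0#
    vanish = antidiag-zero n (d ℕ.+ B) (ℕ.<-≤-trans n<2B (ℕ.+-mono-≤ (ℕ.m≤n+m B d) (ℕ.m≤n+m B d)))

  alt : ℕ → Carrier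
  alt n = altSum (suc n) n

  private
    -- Elimination of `twisted` from `altSum-rec` and `twisted-rec`; `altSum-stable` brings the
    -- summation bounds back to those of `alt`.
    alt-rec : ∀ n → alt (4 ℕ.+ n) ≈ (alt (3 ℕ.+ n) - pow q (2 ℕ.+ n) * alt (1 ℕ.+ n)) + pow q (1 ℕ.+ n) * alt n
    alt-rec n = begin
      altSum (5 ℕ.+ n) (4 ℕ.+ n)
        ≈⟨ altSum-rec (4 ℕ.+ n) (2 ℕ.+ n) ⟩
      altSum (5 ℕ.+ n) (3 ℕ.+ n) - Q * twisted (4 ℕ.+ n) (2 ℕ.+ n)
        ≈⟨ +-cong (altSum-stable 1 (4 ℕ.+ n) (3 ℕ.+ n) (m<m+m (3 ℕ.+ n)))
                  (-‿cong (*-congˡ (twisted-rec (3 ℕ.+ n) n))) ⟩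
      alt (3 ℕ.+ n) - Q * (altSum (4 ℕ.+ n) (1 ℕ.+ n) - u * altSum (3 ℕ.+ n) n)
        ≈⟨ +-congˡ (-‿cong (*-congˡ (+-cong (altSum-stable 2 (2 ℕ.+ n) (1 ℕ.+ n) (m<m+m (1 ℕ.+ n)))
                                            (-‿cong (*-congˡ (altSum-stable 2 (1 ℕ.+ n) n (m<m+m n))))))) ⟩
      alt (3 ℕ.+ n) - Q * (alt (1 ℕ.+ n) - u * alt n)
        ≈⟨ linear₁ qu (solve 6 (λ q u Q a b d →
             (a :- (q :* Q) :* (b :- u :* d)) :+ (Q :* d) :* :1
          := ((a :- (q :* Q) :* b) :+ Q :* d) :+ (Q :* d) :* (q :* u)) refl
           q u (pow q (1 ℕ.+ n)) (alt (3 ℕ.+ n)) (alt (1 ℕ.+ n)) (alt n)) ⟩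
      (alt (3 ℕ.+ n) - Q * alt (1 ℕ.+ n)) + pow q (1 ℕ.+ n) * alt n ∎
      where
      Q = pow q (2 ℕ.+ n)
      m<m+m : ∀ m → m < suc m ℕ.+ suc m
      m<m+m m = ℕ.m≤m+n (suc m) (suc m)

  -- The induction hypothesis cancels the first term on the right of `alt-rec` against the last, and
  -- what remains is the claim for the next index. So the fourth-order recurrence needs only one
  -- base case, E_3 = - q E_0.
  alt-step : ∀ n → alt (3 ℕ.+ n) ≈ - (pow q (1 ℕ.+ n) * alt n)
  alt-step zero = solve 1 (λ q →
       (((:0 :+ :1 :* (:1 :* :1))
         :+ :- :1 :* (:1 :* (:1 :+ (q :* :1) :* (:1 :+ (q :* :1) :* :0))))
         :+ :- :- :1 :* ((q :* :1) :* (:0 :+ (q :* (q :* :1)) :* :0)))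
         :+ :- :- :- :1 :* ((q :* (q :* (q :* :1))) :* :0)
    := :- ((q :* :1) :* (:0 :+ :1 :* (:1 :* :1)))) refl q
  alt-step (suc n) = linear₂ (alt-rec n) (alt-step n)
    (solve 6 (λ Q P a b d e →
       (e :+ :1 :* ((a :- Q :* b) :+ P :* d)) :+ :1 :* :- (P :* d)
    := (:- (Q :* b) :+ :1 :* e) :+ :1 :* a) refl
      (pow q (2 ℕ.+ n)) (pow q (1 ℕ.+ n)) (alt (3 ℕ.+ n)) (alt (1 ℕ.+ n)) (alt n) (alt (4 ℕ.+ n)))

  private
    alt-step₂ : ∀ n → alt (6 ℕ.+ n) ≈ pow q ((4 ℕ.+ n) ℕ.+ (1 ℕ.+ n)) * alt n
    alt-step₂ n = begin
      alt (6 ℕ.+ n)                       ≈⟨ alt-step (3 ℕ.+ n) ⟩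
      - (pow q (4 ℕ.+ n) * alt (3 ℕ.+ n)) ≈⟨ -‿cong (*-congˡ (alt-step n)) ⟩
      - (pow q (4 ℕ.+ n) * - (pow q (1 ℕ.+ n) * alt n))
        ≈⟨ solve 3 (λ a b c → :- (a :* :- (b :* c)) := (a :* b) :* c) refl _ _ _ ⟩
      (pow q (4 ℕ.+ n) * pow q (1 ℕ.+ n)) * alt n   ≈⟨ *-congʳ (pow-+ q (4 ℕ.+ n) (1 ℕ.+ n)) ⟨
      pow q ((4 ℕ.+ n) ℕ.+ (1 ℕ.+ n)) * alt n ∎

  -- The value is q^(t(6t-1)); the factor q^t on the left avoids the subtraction. The exponents
  -- found for the nonzero residues are generalised pentagonal numbers m(3m±1)/2.
  alt-6t : ∀ t → pow q t * alt (t ℕ.* 6) ≈ pow q (6 ℕ.* (t ℕ.* t))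
  alt-6t zero = solve 0 (:1 :* (:0 :+ :1 :* (:1 :* :1)) := :1) refl
  alt-6t (suc t) = begin
    (q * pow q t) * alt (6 ℕ.+ n)
      ≈⟨ *-congˡ (alt-step₂ n) ⟩
    (q * pow q t) * (pow q e * alt n)
      ≈⟨ solve 4 (λ q a b c → (q :* a) :* (b :* c) := (q :* b) :* (a :* c)) refl _ _ _ _ ⟩
    (q * pow q e) * (pow q t * alt n)
      ≈⟨ *-congˡ (alt-6t t) ⟩
    pow q (suc e) * pow q (6 ℕ.* (t ℕ.* t))
      ≈⟨ pow-+ q (suc e) _ ⟨
    pow q (suc e ℕ.+ 6 ℕ.* (t ℕ.* t))
      ≈⟨ pow-≡ q (exponent t) ⟩
    pow q (6 ℕ.* (suc t ℕ.* suc t)) ∎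
    where
    n = t ℕ.* 6
    e = (4 ℕ.+ n) ℕ.+ (1 ℕ.+ n)
    exponent : ∀ t → suc ((4 ℕ.+ t ℕ.* 6) ℕ.+ (1 ℕ.+ t ℕ.* 6)) ℕ.+ 6 ℕ.* (t ℕ.* t) ≡ 6 ℕ.* (suc t ℕ.* suc t)
    exponent = ℕSolver.solve-∀

  private
    alt-6t+1 : ∀ t → alt (1 ℕ.+ t ℕ.* 6) ≈ pow q (t ℕ.* suc (6 ℕ.* t))
    alt-6t+1 zero = solve 0 ((:0 :+ :1 :* (:1 :* :1)) :+ :- :1 :* (:1 :* :0) := :1) refl
    alt-6t+1 (suc t) = begin
      alt (6 ℕ.+ (1 ℕ.+ n))                     ≈⟨ alt-step₂ (1 ℕ.+ n) ⟩
      pow q e * alt (1 ℕ.+ n)                   ≈⟨ *-congˡ (alt-6t+1 t) ⟩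
      pow q e * pow q (t ℕ.* suc (6 ℕ.* t))     ≈⟨ pow-+ q e _ ⟨
      pow q (e ℕ.+ t ℕ.* suc (6 ℕ.* t))         ≈⟨ pow-≡ q (exponent t) ⟩
      pow q (suc t ℕ.* suc (6 ℕ.* suc t))       ∎
      where
      n = t ℕ.* 6
      e = (5 ℕ.+ n) ℕ.+ (2 ℕ.+ n)
      exponent : ∀ t → ((5 ℕ.+ t ℕ.* 6) ℕ.+ (2 ℕ.+ t ℕ.* 6)) ℕ.+ t ℕ.* suc (6 ℕ.* t) ≡ suc t ℕ.* suc (6 ℕ.* suc t)
      exponent = ℕSolver.solve-∀

  -- E_2 = 1 - 1, and the recurrence of step three preserves zero. With 2k = 6t+2 this is the
  -- vanishing of α_k for k ≡ 1 mod 3.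
  alt-6t+2 : ∀ t → alt (2 ℕ.+ t ℕ.* 6) ≈ 0#
  alt-6t+2 zero = solve 1 (λ q →
       ((:0 :+ :1 :* (:1 :* :1))
         :+ :- :1 :* (:1 :* (:1 :+ (q :* :1) :* :0)))
         :+ :- :- :1 :* ((q :* :1) :* :0)
    := :0) refl q
  alt-6t+2 (suc t) = begin
    alt (6 ℕ.+ (2 ℕ.+ t ℕ.* 6))                             ≈⟨ alt-step₂ (2 ℕ.+ t ℕ.* 6) ⟩
    pow q ((6 ℕ.+ t ℕ.* 6) ℕ.+ (3 ℕ.+ t ℕ.* 6)) * alt (2 ℕ.+ t ℕ.* 6)                           ≈⟨ *-congˡ (alt-6t+2 t) ⟩
    pow q ((6 ℕ.+ t ℕ.* 6) ℕ.+ (3 ℕ.+ t ℕ.* 6)) * 0#        ≈⟨ zeroʳ _ ⟩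
    0#                                                      ∎

  alt-6t+4 : ∀ t → alt (4 ℕ.+ t ℕ.* 6) ≈ - pow q ((2 ℕ.+ t ℕ.* 6) ℕ.+ t ℕ.* suc (6 ℕ.* t))
  alt-6t+4 t = begin
    alt (4 ℕ.+ t ℕ.* 6)                                          ≈⟨ alt-step (1 ℕ.+ t ℕ.* 6) ⟩
    - (pow q (2 ℕ.+ t ℕ.* 6) * alt (1 ℕ.+ t ℕ.* 6))              ≈⟨ -‿cong (*-congˡ (alt-6t+1 t)) ⟩
    - (pow q (2 ℕ.+ t ℕ.* 6) * pow q (t ℕ.* suc (6 ℕ.* t)))      ≈⟨ -‿cong (pow-+ q (2 ℕ.+ t ℕ.* 6) _) ⟨
    - pow q ((2 ℕ.+ t ℕ.* 6) ℕ.+ t ℕ.* suc (6 ℕ.* t))            ∎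

-- Bailey pairs relative to a = q, with cleared denominators.

module BaileyPairs {c ℓ : Level} (R : CommutativeRing c ℓ)
  (q u : CommutativeRing.Carrier R) (qu : IsInverse R q u)
  (N : ℕ) (cancel : QBinomial.Cancellable R q u qu N) where

  open CommutativeRing R hiding (zero)
  open Over R
  open QBinomial R q u qu
  open RingSolver R
  open Sums R
  open import Relation.Binary.Reasoning.Setoid setoid

  -- [2n+1 choose n-k], indexed from the other side so that it vanishes for k > n.
  midbin : ℕ → ℕ → Carrier
  midbin n k = qbin q (suc (n ℕ.+ n)) (suc (n ℕ.+ k))

  midbin-zero : ∀ n k → n < k → midbin n k ≈ 0#
  midbin-zero n k n<k = qbin-zero (s≤s (ℕ.+-monoʳ-< n n<k))

  midbin-poch : ∀ k r → midbin (k ℕ.+ r) k * pochPow 1 r ≈ pochPow (suc (suc (k ℕ.+ r ℕ.+ k))) r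
  midbin-poch k r = trans (*-congʳ (reflexive (≡.cong (λ m → qbin q m (suc (k ℕ.+ r ℕ.+ k))) (top k r))))
                          (qbin-pochˡ (suc (k ℕ.+ r ℕ.+ k)) r)
    where
    top : ∀ k r → suc (k ℕ.+ r ℕ.+ (k ℕ.+ r)) ≡ suc (k ℕ.+ r ℕ.+ k) ℕ.+ r
    top = ℕSolver.solve-∀

  qbin-pochPow : ∀ n s → pochPow 1 n * (qbin q (n ℕ.+ s) n * pochPow 1 s) ≈ pochPow 1 (n ℕ.+ s)
  qbin-pochPow n s = trans (*-congˡ (qbin-pochˡ n s)) (sym (pochPow-split 1 n s))

  pochPow-join : ∀ i m j n → j ≡ i ℕ.+ m → pochPow i m * pochPow j n ≈ pochPow i (m ℕ.+ n)
  pochPow-join i m _ n ≡.refl = sym (pochPow-split i m n)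

  -- With m = n+s, both sides become (q)_(2m+1) after multiplication by (q)_n (q)_s. It trades the
  -- normalising factor of a Bailey pair at m for the one at n.
  qbin-midbin : ∀ n s → n ℕ.+ s < N →
    qbin q (n ℕ.+ s) n * pochPow (suc (n ℕ.+ s)) (suc (n ℕ.+ s)) ≈
    pochPow (suc n) (suc n) * (midbin (n ℕ.+ s) n * pochPow (suc (suc (n ℕ.+ n))) s)
  qbin-midbin n s m<N = cancel n (ℕ.≤-<-trans (ℕ.m≤m+n n s) m<N) (cancel s (ℕ.≤-<-trans (ℕ.m≤n+m s n) m<N) (begin
    pochPow 1 s * (pochPow 1 n * (qbin q m n * pochPow (suc m) (suc m)))
      ≈⟨ solve 4 (λ a b x y → a :* (b :* (x :* y)) := (b :* (x :* a)) :* y) refl _ _ _ _ ⟩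
    (pochPow 1 n * (qbin q m n * pochPow 1 s)) * pochPow (suc m) (suc m)
      ≈⟨ *-congʳ (qbin-pochPow n s) ⟩
    pochPow 1 m * pochPow (suc m) (suc m)
      ≈⟨ pochPow-join 1 m (suc m) (suc m) ≡.refl ⟩
    pochPow 1 (m ℕ.+ suc m)
      ≈⟨ pochPow-≡ {i = 1} ≡.refl (total n s) ⟩
    pochPow 1 ((n ℕ.+ suc n ℕ.+ s) ℕ.+ s)
      ≈⟨ pochPow-join 1 (n ℕ.+ suc n ℕ.+ s) _ s (start₂ n s) ⟨
    pochPow 1 (n ℕ.+ suc n ℕ.+ s) * pochPow (suc (suc (m ℕ.+ n))) s
      ≈⟨ *-congʳ (pochPow-join 1 (n ℕ.+ suc n) _ s (start₁ n)) ⟨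
    pochPow 1 (n ℕ.+ suc n) * pochPow (suc (suc (n ℕ.+ n))) s * pochPow (suc (suc (m ℕ.+ n))) s
      ≈⟨ *-cong (*-congʳ (pochPow-join 1 n (suc n) (suc n) ≡.refl)) (midbin-poch n s) ⟨
    pochPow 1 n * pochPow (suc n) (suc n) * pochPow (suc (suc (n ℕ.+ n))) s * (midbin m n * pochPow 1 s)
      ≈⟨ solve 5 (λ a b x y z → b :* x :* z :* (y :* a) := a :* (b :* (x :* (y :* z)))) refl _ _ _ _ _ ⟩
    pochPow 1 s * (pochPow 1 n * (pochPow (suc n) (suc n) * (midbin m n * pochPow (suc (suc (n ℕ.+ n))) s))) ∎))
    where
    m = n ℕ.+ s
    total : ∀ n s → (n ℕ.+ s) ℕ.+ suc (n ℕ.+ s) ≡ (n ℕ.+ suc n ℕ.+ s) ℕ.+ s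
    total = ℕSolver.solve-∀
    start₁ : ∀ n → suc (suc (n ℕ.+ n)) ≡ 1 ℕ.+ (n ℕ.+ suc n)
    start₁ = ℕSolver.solve-∀
    start₂ : ∀ n s → suc (suc (n ℕ.+ s ℕ.+ n)) ≡ 1 ℕ.+ (n ℕ.+ suc n ℕ.+ s)
    start₂ = ℕSolver.solve-∀

  -- Both sides become (q^(n+k+2))_(r+2s) after multiplication by (q)_r (q)_s. The right side
  -- isolates [2m+1 choose m-k]; with r+s fixed, only the other two factors depend on n, and they
  -- are those of `sum-qbin-poch` for c = 2k+1.
  midbin-midbin : ∀ k r s → r < N → s < N → let n = k ℕ.+ r; m = n ℕ.+ s in
    midbin m n * pochPow (suc (suc (n ℕ.+ n))) s * midbin n k ≈
    midbin m k * (qbin q (r ℕ.+ s) r * pochPow (suc (suc (n ℕ.+ k))) s)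
  midbin-midbin k r s r<N s<N = cancel r r<N (cancel s s<N (begin
    pochPow 1 s * (pochPow 1 r * (midbin m n * pochPow (suc (suc (n ℕ.+ n))) s * midbin n k))
      ≈⟨ solve 5 (λ a b x y z → a :* (b :* (x :* y :* z)) := (z :* b) :* y :* (x :* a)) refl _ _ _ _ _ ⟩
    (midbin n k * pochPow 1 r) * pochPow (suc (suc (n ℕ.+ n))) s * (midbin m n * pochPow 1 s)
      ≈⟨ *-cong (*-congʳ (midbin-poch k r)) (midbin-poch n s) ⟩
    pochPow i r * pochPow (suc (suc (n ℕ.+ n))) s * pochPow (suc (suc (m ℕ.+ n))) s
      ≈⟨ *-congʳ (pochPow-join i r _ s (start₁ k r)) ⟩
    pochPow i (r ℕ.+ s) * pochPow (suc (suc (m ℕ.+ n))) s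
      ≈⟨ pochPow-join i (r ℕ.+ s) _ s (start₂ k r s) ⟩
    pochPow i (r ℕ.+ s ℕ.+ s)
      ≈⟨ pochPow-≡ {i = i} ≡.refl (ℕ.+-comm (r ℕ.+ s) s) ⟩
    pochPow i (s ℕ.+ (r ℕ.+ s))
      ≈⟨ pochPow-join i s _ (r ℕ.+ s) (start₃ k r s) ⟨
    pochPow i s * pochPow (suc (suc (k ℕ.+ (r ℕ.+ s) ℕ.+ k))) (r ℕ.+ s)
      ≈⟨ *-congˡ (midbin-poch k (r ℕ.+ s)) ⟨
    pochPow i s * (midbin (k ℕ.+ (r ℕ.+ s)) k * pochPow 1 (r ℕ.+ s))
      ≈⟨ *-congˡ (*-cong (reflexive (≡.cong (λ m → midbin m k) (≡.sym (ℕ.+-assoc k r s)))) (sym (qbin-pochPow r s))) ⟩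
    pochPow i s * (midbin m k * (pochPow 1 r * (qbin q (r ℕ.+ s) r * pochPow 1 s)))
      ≈⟨ solve 5 (λ a b x y z → z :* (x :* (b :* (y :* a))) := a :* (b :* (x :* (y :* z)))) refl _ _ _ _ _ ⟩
    pochPow 1 s * (pochPow 1 r * (midbin m k * (qbin q (r ℕ.+ s) r * pochPow i s))) ∎))
    where
    n = k ℕ.+ r
    m = n ℕ.+ s
    i = suc (suc (n ℕ.+ k))
    start₁ : ∀ k r → suc (suc (k ℕ.+ r ℕ.+ (k ℕ.+ r))) ≡ suc (suc (k ℕ.+ r ℕ.+ k)) ℕ.+ r
    start₁ = ℕSolver.solve-∀
    start₂ : ∀ k r s → suc (suc (k ℕ.+ r ℕ.+ s ℕ.+ (k ℕ.+ r))) ≡ suc (suc (k ℕ.+ r ℕ.+ k)) ℕ.+ (r ℕ.+ s)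
    start₂ = ℕSolver.solve-∀
    start₃ : ∀ k r s → suc (suc (k ℕ.+ (r ℕ.+ s) ℕ.+ k)) ≡ suc (suc (k ℕ.+ r ℕ.+ k)) ℕ.+ s
    start₃ = ℕSolver.solve-∀

  private
    chainTerm : ℕ → ℕ → ℕ → Carrier
    chainTerm m n k = pow q (n ℕ.* suc n) * (midbin m n * pochPow (suc (suc (n ℕ.+ n))) (m ℕ.∸ n) * midbin n k)

    chainTerm-zero : ∀ m n k → n < k → chainTerm m n k ≈ 0#
    chainTerm-zero m n k n<k =
      trans (*-congˡ (trans (*-congˡ (midbin-zero n k n<k)) (zeroʳ _))) (zeroʳ _)

    chainTerm-split : ∀ k M r → r ≤ M → M < N → chainTerm (k ℕ.+ M) (k ℕ.+ r) k ≈
      (pow q (k ℕ.* suc k) * midbin (k ℕ.+ M) k) *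
      (pow q (r ℕ.* r ℕ.+ r ℕ.* suc (k ℕ.+ k)) * qbin q M r * pochPow (suc (suc (k ℕ.+ k) ℕ.+ r)) (M ℕ.∸ r))
    chainTerm-split k M r r≤M M<N = begin
      chainTerm (k ℕ.+ M) (k ℕ.+ r) k
        ≡⟨ ≡.cong (λ m → pow q (n ℕ.* suc n) * (midbin m n * pochPow (suc (suc (n ℕ.+ n))) (m ℕ.∸ n) * midbin n k)) m≡ ⟩
      pow q (n ℕ.* suc n) * (midbin m n * pochPow (suc (suc (n ℕ.+ n))) (m ℕ.∸ n) * midbin n k)
        ≡⟨ ≡.cong (λ s → pow q (n ℕ.* suc n) * (midbin m n * pochPow (suc (suc (n ℕ.+ n))) s * midbin n k)) (ℕ.m+n∸m≡n n s) ⟩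
      pow q (n ℕ.* suc n) * (midbin m n * pochPow (suc (suc (n ℕ.+ n))) s * midbin n k)
        ≈⟨ *-congˡ (midbin-midbin k r s (ℕ.≤-<-trans r≤M M<N) (ℕ.≤-<-trans (ℕ.m∸n≤m M r) M<N)) ⟩
      pow q (n ℕ.* suc n) * (midbin m k * (qbin q (r ℕ.+ s) r * pochPow (suc (suc (n ℕ.+ k))) s))
        ≈⟨ *-cong (trans (pow-≡ q (exponent k r)) (pow-+ q (k ℕ.* suc k) _))
             (*-cong (reflexive (≡.cong (λ m → midbin m k) (≡.sym m≡)))
               (*-cong (reflexive (≡.cong (λ m → qbin q m r) (ℕ.m+[n∸m]≡n r≤M)))
                       (pochPow-≡ {n = s} (index k r) ≡.refl))) ⟩
      (pow q (k ℕ.* suc k) * pow q e) * (midbin (k ℕ.+ M) k * (qbin q M r * pochPow (suc (suc (k ℕ.+ k) ℕ.+ r)) s))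
        ≈⟨ solve 5 (λ a b x y z → (a :* b) :* (x :* (y :* z)) := (a :* x) :* (b :* y :* z)) refl _ _ _ _ _ ⟩
      (pow q (k ℕ.* suc k) * midbin (k ℕ.+ M) k) * (pow q e * qbin q M r * pochPow (suc (suc (k ℕ.+ k) ℕ.+ r)) s) ∎
      where
      s = M ℕ.∸ r
      n = k ℕ.+ r
      m = n ℕ.+ s
      e = r ℕ.* r ℕ.+ r ℕ.* suc (k ℕ.+ k)
      m≡ : k ℕ.+ M ≡ m
      m≡ = ≡.trans (≡.cong (k ℕ.+_) (≡.sym (ℕ.m+[n∸m]≡n r≤M))) (≡.sym (ℕ.+-assoc k r s))
      exponent : ∀ k r → (k ℕ.+ r) ℕ.* suc (k ℕ.+ r) ≡ k ℕ.* suc k ℕ.+ (r ℕ.* r ℕ.+ r ℕ.* suc (k ℕ.+ k))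
      exponent = ℕSolver.solve-∀
      index : ∀ k r → suc (suc (k ℕ.+ r ℕ.+ k)) ≡ suc (suc (k ℕ.+ k) ℕ.+ r)
      index = ℕSolver.solve-∀

    -- The summation behind Bailey's lemma. Terms with n < k vanish, and n = k+r turns the others
    -- into a common factor times the Durfee sum for M = m-k and c = 2k+1, which equals 1.
    sum-chainTerm : ∀ m k → m < N →
      sumTo (suc m) (λ n → chainTerm m n k) ≈ pow q (k ℕ.* suc k) * midbin m k
    sum-chainTerm m k m<N with k ℕ.≤? m
    ... | no k≰m = trans
      (sumTo-zero (suc m) (λ n n<1+m → chainTerm-zero m n k (ℕ.≤-<-trans (ℕ.s≤s⁻¹ n<1+m) m<k)))
      (sym (trans (*-congˡ (midbin-zero m k m<k)) (zeroʳ _)))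
      where m<k = ℕ.≰⇒> k≰m
    ... | yes k≤m with m ℕ.∸ k | ℕ.m+[n∸m]≡n k≤m
    ...   | M | ≡.refl = begin
      sumTo (suc (k ℕ.+ M)) (λ n → chainTerm (k ℕ.+ M) n k)
        ≡⟨ ≡.cong (λ m → sumTo m (λ n → chainTerm (k ℕ.+ M) n k)) (≡.sym (ℕ.+-suc k M)) ⟩
      sumTo (k ℕ.+ suc M) (λ n → chainTerm (k ℕ.+ M) n k)
        ≈⟨ sumTo-split k (suc M) _ ⟩
      sumTo k (λ n → chainTerm (k ℕ.+ M) n k) + sumTo (suc M) (λ r → chainTerm (k ℕ.+ M) (k ℕ.+ r) k)
        ≈⟨ +-cong (sumTo-zero k (λ n n<k → chainTerm-zero (k ℕ.+ M) n k n<k))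
             (trans (sumTo-cong< (suc M) (λ r r<1+M →
                 chainTerm-split k M r (ℕ.s≤s⁻¹ r<1+M) (ℕ.≤-<-trans (ℕ.m≤n+m M k) m<N)))
               (sumTo-*ˡ (suc M) _ _)) ⟩
      0# + Z * sumTo (suc M) (λ r → pow q (r ℕ.* r ℕ.+ r ℕ.* suc (k ℕ.+ k)) * qbin q M r * pochPow (suc (suc (k ℕ.+ k) ℕ.+ r)) (M ℕ.∸ r))
        ≈⟨ trans (+-identityˡ _) (*-congˡ (sum-qbin-poch M (suc (k ℕ.+ k)))) ⟩
      Z * 1#
        ≈⟨ *-identityʳ Z ⟩
      Z ∎
      where Z = pow q (k ℕ.* suc k) * midbin (k ℕ.+ M) k

  -- In the usual normalisation (relative to a = q) this is a Bailey pair
  -- β_n = Σ_k α_k / ((q)_{n-k} (q²)_{n+k}) with β_n = b n / (q)_n and a k = (1 - q) α_k; clearing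
  -- denominators makes sense of it at a root of unity.
  IsBaileyPair : (ℕ → Carrier) → (ℕ → Carrier) → Set ℓ
  IsBaileyPair a b = ∀ n → n < N → pochPow (suc n) (suc n) * b n ≈ sumTo N (λ k → a k * midbin n k)

  -- Bailey's lemma with both parameters sent to infinity. In the cleared normalisation 1 /
  -- ((q)_(m-n) (q)_n) becomes [m choose n], which is why the new b has the shape of one layer of
  -- `G`.
  baileyChain : ∀ {a b} → IsBaileyPair a b →
    IsBaileyPair (λ k → pow q (k ℕ.* suc k) * a k)
                 (λ m → sumTo (suc m) (λ n → pow q (n ℕ.* suc n) * qbin q m n * b n))
  baileyChain {a} {b} pair m m<N = begin
    pochPow (suc m) (suc m) * sumTo (suc m) (λ n → pow q (n ℕ.* suc n) * qbin q m n * b n)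
      ≈⟨ sumTo-*ˡ (suc m) _ _ ⟨
    sumTo (suc m) (λ n → pochPow (suc m) (suc m) * (pow q (n ℕ.* suc n) * qbin q m n * b n))
      ≈⟨ sumTo-cong< (suc m) (λ n n<1+m → expand n (ℕ.s≤s⁻¹ n<1+m)) ⟩
    sumTo (suc m) (λ n → sumTo N (λ k → a k * chainTerm m n k))
      ≈⟨ sumTo-swap (suc m) N _ ⟩
    sumTo N (λ k → sumTo (suc m) (λ n → a k * chainTerm m n k))
      ≈⟨ sumTo-cong N (λ k → trans (sumTo-*ˡ (suc m) _ _) (trans (*-congˡ (sum-chainTerm m k m<N))
           (solve 3 (λ a b x → a :* (b :* x) := (b :* a) :* x) refl _ _ _))) ⟩
    sumTo N (λ k → (pow q (k ℕ.* suc k) * a k) * midbin m k) ∎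
    where
    expand : ∀ n → n ≤ m → pochPow (suc m) (suc m) * (pow q (n ℕ.* suc n) * qbin q m n * b n) ≈
                            sumTo N (λ k → a k * chainTerm m n k)
    expand n n≤m = begin
      pochPow (suc m) (suc m) * (E * qbin q m n * b n)
        ≈⟨ solve 4 (λ p e x y → p :* (e :* x :* y) := e :* ((x :* p) :* y)) refl _ _ _ _ ⟩
      E * ((qbin q m n * pochPow (suc m) (suc m)) * b n)
        ≈⟨ *-congˡ (*-congʳ (≡.subst
             (λ m′ → qbin q m′ n * pochPow (suc m′) (suc m′) ≈ pochPow (suc n) (suc n) * (midbin m′ n * P))
             n+s≡m (qbin-midbin n s (≡.subst (_< N) (≡.sym n+s≡m) m<N)))) ⟩
      E * ((pochPow (suc n) (suc n) * (midbin m n * P)) * b n)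
        ≈⟨ solve 5 (λ e p x y z → e :* ((p :* (x :* y)) :* z) := (e :* (x :* y)) :* (p :* z)) refl _ _ _ _ _ ⟩
      (E * (midbin m n * P)) * (pochPow (suc n) (suc n) * b n)
        ≈⟨ *-congˡ (pair n (ℕ.≤-<-trans n≤m m<N)) ⟩
      (E * (midbin m n * P)) * sumTo N (λ k → a k * midbin n k)
        ≈⟨ sumTo-*ˡ N _ _ ⟨
      sumTo N (λ k → (E * (midbin m n * P)) * (a k * midbin n k))
        ≈⟨ sumTo-cong N (λ k → solve 5 (λ e x y a z → (e :* (x :* y)) :* (a :* z) := a :* (e :* (x :* y :* z))) refl _ _ _ _ _) ⟩
      sumTo N (λ k → a k * chainTerm m n k) ∎
      where
      s = m ℕ.∸ n
      E = pow q (n ℕ.* suc n)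
      P = pochPow (suc (suc (n ℕ.+ n))) s
      n+s≡m = ℕ.m+[n∸m]≡n n≤m

  -- The unit Bailey pair at a = q has α_k = (-1)^k q^C(k,2) (1 - q^(2k+1)) / (1 - q); the factor 1
  -- - q has been cleared.
  unitCoeff : ℕ → Carrier
  unitCoeff k = signPow k 1# * (pow q (choose₂ k) * (1# - pow q (suc (k ℕ.+ k))))

  unit : ℕ → Carrier
  unit zero    = 1#
  unit (suc _) = 0#

  private
    -- Gosper summation of the unit Bailey pair: the factor 1 - q^n makes the partial sums closed.
    unit-partial : ∀ n K → (1# - pow q n) * sumTo K (λ k → unitCoeff k * midbin n k) ≈
      - (signPow K 1# * (pow q (choose₂ K) * ((1# - pow q K) * ((1# - pow q (suc (n ℕ.+ K))) * midbin n K))))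
    unit-partial n zero =
      solve 2 (λ a b → a :* :0 := :- (:1 :* (:1 :* ((:1 :- :1) :* b)))) refl _ _
    unit-partial n (suc K) =
      linear₂ (unit-partial n K)
        (≡.subst (λ j → (1# - X) * midbin n K ≈ (1# - pow q (suc j)) * qbin q (suc (n ℕ.+ n)) (suc j))
          (≡.sym (ℕ.+-suc n K)) (qbin-absorbʳ (suc (n ℕ.+ n)) (suc (n ℕ.+ K))))
      (linear₂ (pow-+ q (choose₂ K) K) shift
      (linear₂ (pow-+ q (suc K) K) (pow-+ q (suc n) K)
      (solve 13 (λ q A Q s C C′ S b b′ X Q₂ Y Y′ →
           ((((((:1 :- A) :* (S :+ s :* (C :* (:1 :- Q₂)) :* b)
             :+ :1 :* (:- (s :* (C :* ((:1 :- Q) :* ((:1 :- Y) :* b))))))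
             :+ (s :* C′ :* (:1 :- q :* Q)) :* ((:1 :- Y′) :* b′))
             :+ (:- (s :* (:1 :- q :* Q) :* (:1 :- X) :* b)) :* (C :* Q))
             :+ (s :* C :* b :* (:1 :- q :* Q)) :* A)
             :+ (:- (s :* C :* b :* (:1 :- A))) :* ((q :* Q) :* Q))
             :+ (s :* C :* b :* (:1 :- Q)) :* ((q :* A) :* Q)
        := (((((:- (:- s :* (C′ :* ((:1 :- q :* Q) :* ((:1 :- Y′) :* b′))))
             :+ :1 :* ((:1 :- A) :* S))
             :+ (s :* C′ :* (:1 :- q :* Q)) :* ((:1 :- X) :* b))
             :+ (:- (s :* (:1 :- q :* Q) :* (:1 :- X) :* b)) :* C′)
             :+ (s :* C :* b :* (:1 :- q :* Q)) :* (X :* Q))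
             :+ (:- (s :* C :* b :* (:1 :- A))) :* Q₂)
             :+ (s :* C :* b :* (:1 :- Q)) :* Y) refl
        q (pow q n) (pow q K) (signPow K 1#) (pow q (choose₂ K)) (pow q (choose₂ (suc K)))
        (sumTo K (λ k → unitCoeff k * midbin n k)) (midbin n K) (midbin n (suc K))
        X (pow q (suc (K ℕ.+ K))) (pow q (suc (n ℕ.+ K))) (pow q (suc (n ℕ.+ suc K))))))
      where
      -- `X` is q^(n-K), the power that `qbin-absorbʳ` supplies here; for K > n the exponent is
      -- negative.
      X = pow q (suc (n ℕ.+ n)) * pow u (suc (n ℕ.+ K))

      shift : X * pow q K ≈ pow q n
      shift = begin
        (pow q (suc (n ℕ.+ n)) * pow u j) * pow q K
          ≈⟨ solve 3 (λ a b c → (a :* b) :* c := (a :* c) :* b) refl _ _ _ ⟩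
        (pow q (suc (n ℕ.+ n)) * pow q K) * pow u j
          ≈⟨ *-congʳ (pow-+ q (suc (n ℕ.+ n)) K) ⟨
        pow q (suc (n ℕ.+ n) ℕ.+ K) * pow u j
          ≈⟨ *-congʳ (trans (pow-≡ q (exponent n K)) (pow-+ q n j)) ⟩
        (pow q n * pow q j) * pow u j
          ≈⟨ trans (*-assoc _ _ _) (*-congˡ (pow-inverse qu j)) ⟩
        pow q n * 1#
          ≈⟨ *-identityʳ _ ⟩
        pow q n ∎
        where
        j = suc (n ℕ.+ K)
        exponent : ∀ n K → suc (n ℕ.+ n) ℕ.+ K ≡ n ℕ.+ suc (n ℕ.+ K)
        exponent = ℕSolver.solve-∀

    unit-sum-0 : ∀ K → 0 < K → sumTo K (λ k → unitCoeff k * midbin 0 k) ≈ 1# - q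
    unit-sum-0 (suc zero) _ = solve 1 (λ q →
      :0 :+ (:1 :* (:1 :* (:1 :- q :* :1))) :* (:1 :+ (q :* :1) :* :0) := :1 :- q) refl q
    unit-sum-0 (suc (suc K)) _ = trans
      (+-cong (unit-sum-0 (suc K) (s≤s z≤n)) (trans (*-congˡ (midbin-zero 0 (suc K) (s≤s z≤n))) (zeroʳ _)))
      (+-identityʳ _)

  -- For a positive index `unit-partial` is taken at K = N, where the boundary binomial is zero. Its
  -- factor 1 - q^(n+1) is the last factor of (q)_(n+1), so multiplying by (q)_n completes a product
  -- that `cancel` removes. At index 0 that factor would be 1 - 1, hence the separate evaluation.
  unit-pair : IsBaileyPair unitCoeff unit
  unit-pair zero 0<N =
    trans (solve 1 (λ q → :1 :* (:1 :- (q :* :1) :* :1) :* :1 := :1 :- q) refl q) (sym (unit-sum-0 N 0<N))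
  unit-pair (suc n) n<N = cancel (suc n) n<N (begin
    (pochPow 1 n * (1# - (q * 1#) * pow q n)) * (pochPow (suc (suc n)) (suc (suc n)) * 0#)
      ≈⟨ solve 2 (λ p a → p :* (a :* :0) := :0) refl _ _ ⟩
    0#
      ≈⟨ solve 4 (λ a b c d → a :* :- (b :* (c :* (d :* :0))) := :0) refl _ _ _ _ ⟨
    pochPow 1 n * - (signPow N 1# * (pow q (choose₂ N) * ((1# - pow q N) * 0#)))
      ≈⟨ *-congˡ (-‿cong (*-congˡ (*-congˡ (*-congˡ (trans (*-congˡ (midbin-zero (suc n) N n<N)) (zeroʳ _)))))) ⟨
    pochPow 1 n * - (signPow N 1# * (pow q (choose₂ N) * ((1# - pow q N) * ((1# - pow q (suc (suc n ℕ.+ N))) * midbin (suc n) N))))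
      ≈⟨ *-congˡ (unit-partial (suc n) N) ⟨
    pochPow 1 n * ((1# - q * pow q n) * Σ)
      ≈⟨ solve 4 (λ p q a s → p :* ((:1 :- q :* a) :* s) := (p :* (:1 :- (q :* :1) :* a)) :* s) refl _ _ _ _ ⟩
    pochPow 1 (suc n) * Σ ∎)
    where Σ = sumTo N (λ k → unitCoeff k * midbin (suc n) k)

  IsBaileyPair-cong : ∀ {a a′ b b′} → (∀ k → a k ≈ a′ k) → (∀ n → b n ≈ b′ n) →
    IsBaileyPair a b → IsBaileyPair a′ b′
  IsBaileyPair-cong a≈a′ b≈b′ pair n n<N =
    trans (*-congˡ (sym (b≈b′ n))) (trans (pair n n<N) (sumTo-cong N (λ k → *-congʳ (a≈a′ k))))

  private
    unit-chain : ∀ m → sumTo (suc m) (λ n → pow q (n ℕ.* suc n) * qbin q m n * unit n) ≈ 1#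
    unit-chain m = begin
      sumTo (suc m) (λ n → pow q (n ℕ.* suc n) * qbin q m n * unit n)
        ≈⟨ sumTo-suc m _ ⟩
      1# * 1# * 1# + sumTo m (λ n → pow q (suc n ℕ.* suc (suc n)) * qbin q m (suc n) * 0#)
        ≈⟨ +-cong (solve 0 (:1 :* :1 :* :1 := :1) refl) (sumTo-zero m (λ _ _ → zeroʳ _)) ⟩
      1# + 0#
        ≈⟨ +-identityʳ 1# ⟩
      1# ∎

  -- The constant sequence `G q 0` is already one chain step away from `unit`, since only n = 0
  -- contributes to that step. Hence the exponent `suc j`.
  G-pair : ∀ j → IsBaileyPair (λ k → pow q (suc j ℕ.* (k ℕ.* suc k)) * unitCoeff k) (G q j)
  G-pair zero = IsBaileyPair-cong
    (λ k → *-congʳ (pow-≡ q (≡.sym (ℕ.+-identityʳ (k ℕ.* suc k))))) unit-chain (baileyChain unit-pair)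
  G-pair (suc j) = IsBaileyPair-cong
    (λ k → trans (sym (*-assoc _ _ _)) (*-congʳ (sym (pow-+ q (k ℕ.* suc k) (suc j ℕ.* (k ℕ.* suc k))))))
    (λ _ → refl) (baileyChain (G-pair j))

-- Arithmetic of triangular exponents.

choose₂-+ : ∀ m n → choose₂ (m ℕ.+ n) ≡ choose₂ m ℕ.+ choose₂ n ℕ.+ m ℕ.* n
choose₂-+ zero    n = ≡.sym (ℕ.+-identityʳ _)
choose₂-+ (suc m) n = ≡.trans (≡.cong (ℕ._+ (m ℕ.+ n)) (choose₂-+ m n)) (rearrange (choose₂ m) (choose₂ n) m n)
  where
  rearrange : ∀ x y m n → x ℕ.+ y ℕ.+ m ℕ.* n ℕ.+ (m ℕ.+ n) ≡ x ℕ.+ m ℕ.+ y ℕ.+ suc m ℕ.* n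
  rearrange = ℕSolver.solve-∀

choose₂-double : ∀ n → choose₂ n ℕ.+ choose₂ n ℕ.+ n ≡ n ℕ.* n
choose₂-double zero    = ≡.refl
choose₂-double (suc n) = ≡.trans (rearrange (choose₂ n) n)
  (≡.trans (≡.cong (ℕ._+ suc (n ℕ.+ n)) (choose₂-double n)) (square n))
  where
  rearrange : ∀ x n → x ℕ.+ n ℕ.+ (x ℕ.+ n) ℕ.+ suc n ≡ x ℕ.+ x ℕ.+ n ℕ.+ suc (n ℕ.+ n)
  rearrange = ℕSolver.solve-∀
  square : ∀ n → n ℕ.* n ℕ.+ suc (n ℕ.+ n) ≡ suc n ℕ.* suc n
  square = ℕSolver.solve-∀

choose₂-/ : ∀ n → (suc n ℕ.* n) / 2 ≡ choose₂ n ℕ.+ n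
choose₂-/ n = ≡.trans (≡.cong (_/ 2) product) (m*n/n≡m (choose₂ n ℕ.+ n) 2)
  where
  rearrange : ∀ x n → x ℕ.+ x ℕ.+ n ℕ.+ n ≡ (x ℕ.+ n) ℕ.* 2
  rearrange = ℕSolver.solve-∀
  product : suc n ℕ.* n ≡ (choose₂ n ℕ.+ n) ℕ.* 2
  product = ≡.trans (ℕ.+-comm n (n ℕ.* n))
    (≡.trans (≡.cong (ℕ._+ n) (≡.sym (choose₂-double n))) (rearrange (choose₂ n) n))

-- Reflection of weights and columns at a primitive root of unity.

module RootOfUnity {c ℓ : Level} (R : CommutativeRing c ℓ)
  (domain : Over.IsIntegralDomainChar0 R) (N′ : ℕ) (q u : CommutativeRing.Carrier R)
  (root : Over.PrimitiveRoot R (suc N′) q) (qu : IsInverse R q u) where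

  open CommutativeRing R hiding (zero)
  open Over R
  open RingSolver R
  open Sums R
  open QBinomial R q u qu
  open import Relation.Binary.Reasoning.Setoid setoid

  private
    N = suc N′

    uq : u * q ≈ 1#
    uq = trans (*-comm u q) qu

    module U = QBinomial R u q uq

    q^N : pow q N ≈ 1#
    q^N = let (h , _) = root in h

    q^i≉1 : ∀ i → 1 ≤ i → i < N → pow q i ≉ 1#
    q^i≉1 = let (_ , h) = root in h

    cancel : Cancellable N
    cancel zero n<N h = trans (sym (*-identityˡ _)) (trans h (*-identityˡ _))
    cancel (suc n) n<N {x} {y} h
      with cancel n (ℕ.<-trans (ℕ.n<1+n n) n<N) (trans (sym (*-assoc _ _ _)) (trans h (*-assoc _ _ _)))
         | (let (_ , integral , _) = domain in integral) (1# - (q * 1#) * pow q n) (x - y)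
    ... | h′ | integral with integral (trans (solve 3 (λ a x y → a :* (x :- y) := a :* x :- a :* y) refl _ x y)
                                       (trans (+-congʳ h′) (-‿inverseʳ _)))
    ...   | inj₁ z = contradiction
              (linear₁ z (solve 2 (λ q a → q :* a :+ (:- :1) :* :0 := :1 :+ (:- :1) :* (:1 :- (q :* :1) :* a)) refl q (pow q n)))
              (q^i≉1 (suc n) (s≤s z≤n) n<N)
    ...   | inj₂ z = linear₁ z (solve 2 (λ x y → x :+ :1 :* :0 := y :+ :1 :* (x :- y)) refl x y)

  open BaileyPairs R q u qu N cancel

  private
    pow-inv : ∀ m n → pow q (m ℕ.+ n) ≈ 1# → pow q m ≈ pow u n
    pow-inv m n h = linear₃ (pow-inverse qu n) (pow-+ q m n) h
      (solve 4 (λ a b c d →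
           ((a :+ (:- a) :* :1) :+ (:- d) :* (a :* b)) :+ d :* :1
        := ((d :+ (:- a) :* (b :* d)) :+ (:- d) :* c) :+ d :* c) refl
        (pow q m) (pow q n) (pow q (m ℕ.+ n)) (pow u n))

    -- Reading the product backwards pairs q^(a+1+i) with u^(b+j-1-i). The two exponents add up to
    -- a+b+j, a period of q, so the factors agree.
    pochPow-reverse : ∀ j a b → pow q (a ℕ.+ b ℕ.+ j) ≈ 1# → pochPow (suc a) j ≈ U.pochPow b j
    pochPow-reverse zero    a b h = refl
    pochPow-reverse (suc j) a b h = begin
      pochPow (suc a) (suc j)
        ≈⟨ pochPow-suc (suc a) j ⟩
      (1# - pow q (suc a)) * pochPow (suc (suc a)) j
        ≈⟨ *-cong (+-congˡ (-‿cong (trans (pow-inv (suc a) (b ℕ.+ j) (trans (pow-≡ q (e₁ a b j)) h)) (pow-+ u b j))))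
                  (pochPow-reverse j (suc a) b (trans (pow-≡ q (e₂ a b j)) h)) ⟩
      (1# - pow u b * pow u j) * U.pochPow b j
        ≈⟨ *-comm _ _ ⟩
      U.pochPow b (suc j) ∎
      where
      e₁ : ∀ a b j → suc a ℕ.+ (b ℕ.+ j) ≡ a ℕ.+ b ℕ.+ suc j
      e₁ = ℕSolver.solve-∀
      e₂ : ∀ a b j → suc a ℕ.+ b ℕ.+ j ≡ a ℕ.+ b ℕ.+ suc j
      e₂ = ℕSolver.solve-∀

    -- Each factor satisfies 1 - q^i = - q^i (1 - u^i), and 1 + ... + j = C(j+1,2).
    pochPow-flip : ∀ j → pochPow 1 j ≈ signPow j 1# * (pow q (choose₂ (suc j)) * U.pochPow 1 j)
    pochPow-flip zero = solve 0 (:1 := :1 :* (:1 :* :1)) refl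
    pochPow-flip (suc j) =
      linear₄ (pochPow-flip j) (pow-+ q (choose₂ (suc j)) (suc j)) qu (pow-inverse qu j)
      (solve 9 (λ q u Q U s C C′ p r →
           (((p :* (:1 :- (q :* :1) :* Q)
           :+ (:1 :- q :* Q) :* (s :* (C :* r)))
           :+ (s :* r :* (:1 :- u :* U)) :* (C :* (q :* Q)))
           :+ (:- (s :* C :* r :* Q :* U)) :* :1)
           :+ (:- (s :* C :* r)) :* :1
        := (((:- s :* (C′ :* (r :* (:1 :- (u :* :1) :* U)))
           :+ (:1 :- q :* Q) :* p)
           :+ (s :* r :* (:1 :- u :* U)) :* C′)
           :+ (:- (s :* C :* r :* Q :* U)) :* (q :* u))
           :+ (:- (s :* C :* r)) :* (Q :* U)) refl
        q u (pow q j) (pow u j) (signPow j 1#) (pow q (choose₂ (suc j))) (pow q (choose₂ (suc (suc j))))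
        (pochPow 1 j) (U.pochPow 1 j))

    -- Reversal identifies (q)_(N-1) with its counterpart in u, while `pochPow-flip` relates them by
    -- the sign and the power; cancelling the product leaves the claim for even and odd N alike.
    sign-choose₂ : signPow N′ 1# * pow q (choose₂ N) ≈ 1#
    sign-choose₂ = cancel N′ (ℕ.n<1+n N′) (begin
      pochPow 1 N′ * (signPow N′ 1# * pow q (choose₂ N))
        ≈⟨ solve 3 (λ a b c → a :* (b :* c) := b :* (c :* a)) refl _ _ _ ⟩
      signPow N′ 1# * (pow q (choose₂ N) * pochPow 1 N′)
        ≈⟨ *-congˡ (*-congˡ (pochPow-reverse N′ 0 1 q^N)) ⟩
      signPow N′ 1# * (pow q (choose₂ N) * U.pochPow 1 N′)
        ≈⟨ pochPow-flip N′ ⟨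
      pochPow 1 N′
        ≈⟨ *-identityʳ _ ⟨
      pochPow 1 N′ * 1# ∎)

  weight : ℕ → ℕ → Carrier
  weight p k = pow q (p ℕ.* (k ℕ.* suc k)) * unitCoeff k

  private
    pow-*-cong : ∀ {x m n} l → pow x m ≈ pow x n → pow x (l ℕ.* m) ≈ pow x (l ℕ.* n)
    pow-*-cong zero h = refl
    pow-*-cong {x} {m} {n} (suc l) h =
      trans (pow-+ x m _) (trans (*-cong h (pow-*-cong {x} {m} {n} l h)) (sym (pow-+ x n _)))

    pow-pronic : ∀ k k′ → k ℕ.+ k′ ≡ N′ → pow q (k ℕ.* suc k) * pow q (k ℕ.* k′) ≈ 1#
    pow-pronic k k′ k+k′ = begin
      pow q (k ℕ.* suc k) * pow q (k ℕ.* k′)   ≈⟨ pow-+ q (k ℕ.* suc k) _ ⟨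
      pow q (k ℕ.* suc k ℕ.+ k ℕ.* k′)         ≈⟨ pow-≡ q (≡.trans (exponent k k′) (≡.cong (λ n → suc n ℕ.* k) k+k′)) ⟩
      pow q (N ℕ.* k)                          ≈⟨ pow-unit N k q^N ⟩
      1#                                       ∎
      where
      exponent : ∀ k k′ → k ℕ.* suc k ℕ.+ k ℕ.* k′ ≡ suc (k ℕ.+ k′) ℕ.* k
      exponent = ℕSolver.solve-∀

    -- Multiplied by q^(kk'), which is symmetric in k and k', either side becomes a power of q^N.
    pow-pronic-reflect : ∀ k k′ → k ℕ.+ k′ ≡ N′ → pow q (k′ ℕ.* suc k′) ≈ pow q (k ℕ.* suc k)
    pow-pronic-reflect k k′ k+k′ = unit-cancel (trans (*-comm _ _) (pow-inverse qu (k ℕ.* k′))) (begin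
      pow q (k ℕ.* k′) * pow q (k′ ℕ.* suc k′)   ≈⟨ *-comm _ _ ⟩
      pow q (k′ ℕ.* suc k′) * pow q (k ℕ.* k′)   ≈⟨ *-congˡ (pow-≡ q (ℕ.*-comm k k′)) ⟩
      pow q (k′ ℕ.* suc k′) * pow q (k′ ℕ.* k)   ≈⟨ pow-pronic k′ k (≡.trans (ℕ.+-comm k′ k) k+k′) ⟩
      1#                                         ≈⟨ pow-pronic k k′ k+k′ ⟨
      pow q (k ℕ.* suc k) * pow q (k ℕ.* k′)     ≈⟨ *-comm _ _ ⟩
      pow q (k ℕ.* k′) * pow q (k ℕ.* suc k)     ∎)

    -- With a = q^k and b = q^k' one has q a b = 1, and `balance` says s' X' b = s X a. Hence s' X'
    -- (1 - q b²) = s' X' - s X, and the same computation for k gives s X - s' X'.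
    unitCoeff-reflect : ∀ k k′ → k ℕ.+ k′ ≡ N′ → unitCoeff k′ ≈ - unitCoeff k
    unitCoeff-reflect k k′ k+k′ = begin
      s′ * (X′ * (1# - pow q (suc (k′ ℕ.+ k′))))
        ≈⟨ *-congˡ (*-congˡ (+-congˡ (-‿cong (*-congˡ (pow-+ q k′ k′))))) ⟩
      s′ * (X′ * (1# - q * (b * b)))
        ≈⟨ linear₂ qab balance (solve 7 (λ q s s′ X X′ a b →
             (s′ :* (X′ :* (:1 :- q :* (b :* b))) :+ (:- (s′ :* X′) :- s :* X) :* :1) :+ (q :* a :- q :* b) :* (s :* X :* a)
          := (:- (s :* (X :* (:1 :- q :* (a :* a)))) :+ (:- (s′ :* X′) :- s :* X) :* (q :* (a :* b))) :+ (q :* a :- q :* b) :* (s′ :* X′ :* b))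
           refl q s s′ X X′ a b) ⟩
      - (s * (X * (1# - q * (a * a))))
        ≈⟨ -‿cong (*-congˡ (*-congˡ (+-congˡ (-‿cong (*-congˡ (pow-+ q k k)))))) ⟨
      - unitCoeff k ∎
      where
      s = signPow k 1#
      s′ = signPow k′ 1#
      X = pow q (choose₂ k)
      X′ = pow q (choose₂ k′)
      a = pow q k
      b = pow q k′
      Y = pow q (k ℕ.* k′)

      qab : q * (a * b) ≈ 1#
      qab = trans (*-congˡ (sym (pow-+ q k k′))) (trans (pow-≡ q (≡.cong suc k+k′)) q^N)

      X²a²Y : (X * X * a) * a * Y ≈ 1#
      X²a²Y = begin
        (X * X * a) * a * Y
          ≈⟨ *-congʳ (*-congʳ (trans (*-congʳ (sym (pow-+ q (choose₂ k) _))) (sym (pow-+ q (choose₂ k ℕ.+ choose₂ k) k)))) ⟩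
        pow q (choose₂ k ℕ.+ choose₂ k ℕ.+ k) * a * Y
          ≈⟨ *-congʳ (trans (*-congʳ (pow-≡ q (choose₂-double k))) (sym (pow-+ q (k ℕ.* k) k))) ⟩
        pow q (k ℕ.* k ℕ.+ k) * Y
          ≈⟨ *-congʳ (pow-≡ q (≡.trans (ℕ.+-comm (k ℕ.* k) k) (≡.sym (ℕ.*-suc k k)))) ⟩
        pow q (k ℕ.* suc k) * Y
          ≈⟨ pow-pronic k k′ k+k′ ⟩
        1# ∎

      ss′XX′Yab : (s * s′) * (X * X′ * Y * (a * b)) ≈ 1#
      ss′XX′Yab = begin
        (s * s′) * (X * X′ * Y * (a * b))
          ≈⟨ *-cong (trans (sym (signPow-+ k k′)) (reflexive (≡.cong (λ n → signPow n 1#) k+k′)))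
               (*-cong (trans (*-congʳ (sym (pow-+ q (choose₂ k) _))) (sym (pow-+ q (choose₂ k ℕ.+ choose₂ k′) _)))
                       (sym (pow-+ q k k′))) ⟩
        signPow N′ 1# * (pow q (choose₂ k ℕ.+ choose₂ k′ ℕ.+ k ℕ.* k′) * pow q (k ℕ.+ k′))
          ≈⟨ *-congˡ (*-congʳ (pow-≡ q (≡.sym (choose₂-+ k k′)))) ⟩
        signPow N′ 1# * (pow q (choose₂ (k ℕ.+ k′)) * pow q (k ℕ.+ k′))
          ≈⟨ *-congˡ (pow-+ q (choose₂ (k ℕ.+ k′)) _) ⟨
        signPow N′ 1# * pow q (choose₂ (suc (k ℕ.+ k′)))
          ≈⟨ *-congˡ (pow-≡ q (≡.cong (λ n → choose₂ (suc n)) k+k′)) ⟩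
        signPow N′ 1# * pow q (choose₂ N)
          ≈⟨ sign-choose₂ ⟩
        1# ∎

      -- The quotient of the two preceding products, both equal to 1, is s s' X' b / (X a); then s²
      -- = 1 moves the sign across.
      balance : s′ * X′ * b ≈ s * X * a
      balance = linear₃ ss′XX′Yab X²a²Y (signPow-square k) (solve 7 (λ s s′ X X′ a b Y →
           ((s′ :* X′ :* b
             :+ (s :* X :* a) :* :1)
             :+ (:- (s′ :* X′ :* b :* s :* s)) :* :1)
             :+ (:- (s′ :* X′ :* b)) :* :1
        := ((s :* X :* a
             :+ (s :* X :* a) :* ((s :* s′) :* (X :* X′ :* Y :* (a :* b))))
             :+ (:- (s′ :* X′ :* b :* s :* s)) :* ((X :* X :* a) :* a :* Y))
             :+ (:- (s′ :* X′ :* b)) :* (s :* s)) refl s s′ X X′ a b Y)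

  weight-reflect : ∀ p k k′ → k ℕ.+ k′ ≡ N′ → weight p k′ ≈ - weight p k
  weight-reflect p k k′ k+k′ = trans
    (*-cong (pow-*-cong {q} {k′ ℕ.* suc k′} {k ℕ.* suc k} p (pow-pronic-reflect k k′ k+k′)) (unitCoeff-reflect k k′ k+k′))
    (solve 2 (λ a b → a :* :- b := :- (a :* b)) refl _ _)

  private
    module A = Alternating R u q uq

  columnSum : ℕ → Carrier
  columnSum k = sumTo N (λ n → pow q n * midbin n k)

  private
    -- Here k = j+m, K = N-1-k and n = K+j = N-1-m, so q^n = u^(m+1). The binomial is (q^(2K+j+2))_j
    -- / (q)_j: its numerator is reversed over the period 2N, its denominator flipped, giving (-1)^j
    -- u^C(j+1,2) [2m+j choose j]_u. Finally C(j+1,2) = C(j,2) + j moves u^j into the common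
    -- prefactor u^(k+1).
    columnTerm : ∀ j m K → (j ℕ.+ m) ℕ.+ K ≡ N′ →
      pow q (K ℕ.+ j) * midbin (K ℕ.+ j) K ≈
      pow u (suc (j ℕ.+ m)) * (signPow j 1# * (pow u (choose₂ j) * qbin u ((j ℕ.+ m ℕ.+ (j ℕ.+ m)) ℕ.∸ j) j))
    columnTerm j m K k+K = begin
      pow q (K ℕ.+ j) * midbin (K ℕ.+ j) K
        ≈⟨ *-cong (pow-inv (K ℕ.+ j) (suc m) (trans (pow-≡ q (≡.trans (e₁ j m K) (≡.cong suc k+K))) q^N)) value ⟩
      pow u (suc m) * (s * (pow u (choose₂ j ℕ.+ j) * B))
        ≈⟨ *-congˡ (*-congˡ (*-congʳ (pow-+ u (choose₂ j) j))) ⟩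
      pow u (suc m) * (s * ((pow u (choose₂ j) * pow u j) * B))
        ≈⟨ solve 5 (λ a b c d e → a :* (b :* ((c :* d) :* e)) := (a :* d) :* (b :* (c :* e))) refl _ _ _ _ _ ⟩
      (pow u (suc m) * pow u j) * (s * (pow u (choose₂ j) * B))
        ≈⟨ *-cong (trans (sym (pow-+ u (suc m) j)) (pow-≡ u (≡.cong suc (ℕ.+-comm m j))))
             (*-congˡ (*-congˡ (reflexive (≡.cong (λ n → qbin u n j) (≡.sym e₃))))) ⟩
      pow u (suc (j ℕ.+ m)) * (s * (pow u (choose₂ j) * qbin u ((j ℕ.+ m ℕ.+ (j ℕ.+ m)) ℕ.∸ j) j)) ∎
      where
      s = signPow j 1#
      B = qbin u (m ℕ.+ m ℕ.+ j) j
      C = choose₂ (suc j)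

      e₁ : ∀ j m K → (K ℕ.+ j) ℕ.+ suc m ≡ suc ((j ℕ.+ m) ℕ.+ K)
      e₁ = ℕSolver.solve-∀

      e₂ : ∀ j m K → suc (K ℕ.+ j ℕ.+ K) ℕ.+ suc (m ℕ.+ m) ℕ.+ j ≡ suc ((j ℕ.+ m) ℕ.+ K) ℕ.* 2
      e₂ = ℕSolver.solve-∀

      e₃ : (j ℕ.+ m ℕ.+ (j ℕ.+ m)) ℕ.∸ j ≡ m ℕ.+ m ℕ.+ j
      e₃ = ≡.trans (≡.cong (ℕ._∸ j) (rearrange j m)) (ℕ.m+n∸n≡m (m ℕ.+ m ℕ.+ j) j)
        where
        rearrange : ∀ j m → j ℕ.+ m ℕ.+ (j ℕ.+ m) ≡ m ℕ.+ m ℕ.+ j ℕ.+ j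
        rearrange = ℕSolver.solve-∀

      j<N : j < N
      j<N = s≤s (≡.subst (j ≤_) k+K (ℕ.≤-trans (ℕ.m≤m+n j m) (ℕ.m≤m+n (j ℕ.+ m) K)))

      period : pow q (suc (K ℕ.+ j ℕ.+ K) ℕ.+ suc (m ℕ.+ m) ℕ.+ j) ≈ 1#
      period = trans (pow-≡ q (≡.trans (e₂ j m K) (≡.cong (λ n → suc n ℕ.* 2) k+K))) (pow-unit N 2 q^N)

      value : midbin (K ℕ.+ j) K ≈ s * (pow u C * B)
      value = cancel j j<N (begin
        pochPow 1 j * midbin (K ℕ.+ j) K
          ≈⟨ *-comm _ _ ⟩
        midbin (K ℕ.+ j) K * pochPow 1 j
          ≈⟨ midbin-poch K j ⟩
        pochPow (suc (suc (K ℕ.+ j ℕ.+ K))) j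
          ≈⟨ pochPow-reverse j (suc (K ℕ.+ j ℕ.+ K)) (suc (m ℕ.+ m)) period ⟩
        U.pochPow (suc (m ℕ.+ m)) j
          ≈⟨ U.qbin-pochʳ (m ℕ.+ m) j ⟨
        B * U.pochPow 1 j
          ≈⟨ linear₂ (signPow-square j) (pow-inverse qu C) (solve 5 (λ s c d B p →
               (B :* p :+ (:- (B :* p)) :* :1) :+ (:- (s :* s :* B :* p)) :* :1
            := ((s :* (c :* p)) :* (s :* (d :* B)) :+ (:- (B :* p)) :* (s :* s)) :+ (:- (s :* s :* B :* p)) :* (c :* d))
             refl s (pow q C) (pow u C) B (U.pochPow 1 j)) ⟩
        (s * (pow q C * U.pochPow 1 j)) * (s * (pow u C * B))
          ≈⟨ *-congʳ (pochPow-flip j) ⟨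
        pochPow 1 j * (s * (pow u C * B)) ∎)

  columnSum-reflect : ∀ k K → k ℕ.+ K ≡ N′ → columnSum K ≈ pow u (suc k) * A.alt (k ℕ.+ k)
  columnSum-reflect k K k+K = begin
    columnSum K
      ≡⟨ ≡.cong (λ n → sumTo n f) N≡ ⟩
    sumTo (K ℕ.+ suc k) f
      ≈⟨ sumTo-split K (suc k) f ⟩
    sumTo K f + sumTo (suc k) (λ j → f (K ℕ.+ j))
      ≈⟨ +-cong (sumTo-zero K (λ n n<K → trans (*-congˡ (midbin-zero n K n<K)) (zeroʳ _)))
                (trans (sumTo-cong< (suc k) term) (sumTo-*ˡ (suc k) _ _)) ⟩
    0# + pow u (suc k) * A.altSum (suc k) (k ℕ.+ k)
      ≈⟨ +-identityˡ _ ⟩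
    pow u (suc k) * A.altSum (suc k) (k ℕ.+ k)
      -- The column has k+1 terms, whereas `A.alt (k ℕ.+ k)` sums 2k+1; the surplus ones have 2j >
      -- 2k and vanish.
      ≈⟨ *-congˡ (A.altSum-stable k (suc k) (k ℕ.+ k) (s≤s (ℕ.+-monoʳ-≤ k (ℕ.n≤1+n k)))) ⟨
    pow u (suc k) * A.altSum (k ℕ.+ suc k) (k ℕ.+ k)
      ≡⟨ ≡.cong (λ n → pow u (suc k) * A.altSum n (k ℕ.+ k)) (ℕ.+-suc k k) ⟩
    pow u (suc k) * A.alt (k ℕ.+ k) ∎
    where
    f : ℕ → Carrier
    f n = pow q n * midbin n K
    N≡ : N ≡ K ℕ.+ suc k
    N≡ = ≡.trans (≡.cong suc (≡.trans (≡.sym k+K) (ℕ.+-comm k K))) (≡.sym (ℕ.+-suc K k))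
    term : ∀ j → j < suc k → f (K ℕ.+ j) ≈
      pow u (suc k) * (signPow j 1# * (pow u (choose₂ j) * qbin u ((k ℕ.+ k) ℕ.∸ j) j))
    term j j<1+k with k ℕ.∸ j | ℕ.m+[n∸m]≡n (ℕ.s≤s⁻¹ j<1+k)
    ... | m | ≡.refl = columnTerm j m K k+K

  -- Identification of the alternating sums with α_k, and assembly of the formula.

  private
    alpha-1 : ∀ k → k % 3 ≡ 1 → alpha q k ≈ 0#
    alpha-1 k h with k % 3
    alpha-1 k ≡.refl | .1 = refl

    alphaValue : ℕ → ℕ → ℕ → Carrier
    alphaValue e d n = signPow e (pow q d * sumTo n (λ i → pow q i))

    alpha-0 : ∀ k → k % 3 ≡ 0 →
      alpha q k ≈ alphaValue ((4 ℕ.* k ℕ.+ 1) / 3) ((k ℕ.* (k ℕ.∸ 2)) / 3) (suc (2 ℕ.* k))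
    alpha-0 k h with k % 3
    alpha-0 k ≡.refl | .0 = refl

    alpha-2 : ∀ k → k % 3 ≡ 2 →
      alpha q k ≈ alphaValue ((4 ℕ.* k ℕ.+ 1) / 3) ((k ℕ.* (k ℕ.∸ 2)) / 3) (suc (2 ℕ.* k))
    alpha-2 k h with k % 3
    alpha-2 k ≡.refl | .2 = refl

    alphaValue-cong : ∀ {e e′ d d′ n n′} → e ≡ e′ → d ≡ d′ → n ≡ n′ → alphaValue e d n ≈ alphaValue e′ d′ n′
    alphaValue-cong ≡.refl ≡.refl ≡.refl = refl

    geometric : ∀ n → (1# - q) * sumTo n (λ i → pow q i) ≈ 1# - pow q n
    geometric zero = solve 1 (λ a → a :* :0 := :1 :- :1) refl _
    geometric (suc n) = linear₁ (geometric n) (solve 3 (λ q s a →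
         (:1 :- q) :* (s :+ a) :+ :1 :* (:1 :- a)
      := (:1 :- q :* a) :+ :1 :* ((:1 :- q) :* s)) refl q _ (pow q n))

    even-sign : ∀ t → signPow (t ℕ.+ t) 1# ≈ 1#
    even-sign t = trans (signPow-+ t t) (signPow-square t)

    -- The powers are those left over in the summand. One factor q^(k²+k) of the weight exceeds the
    -- exponent (p-1)(k²+k) of the theorem; its q^k cancels against the column prefactor and q^(k²)
    -- remains. The q^k on the right completes C(k,2) to C(k+1,2).
    AlphaEvaluation : ℕ → Set ℓ
    AlphaEvaluation k = pow q (k ℕ.* k) * ((1# - pow q (suc (k ℕ.+ k))) * A.alt (k ℕ.+ k)) ≈
                        (1# - q) * (pow q k * alpha q k)

    -- Multiplication by 1 - q collapses the geometric factor of α_k to 1 - q^(2k+1), the factor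
    -- already present on the left, so only an identity between signed monomials is left to check.
    alphaEvaluation-from : ∀ k e d → alpha q k ≈ alphaValue e d (suc (k ℕ.+ k)) →
      pow q (k ℕ.* k) * A.alt (k ℕ.+ k) ≈ signPow e 1# * pow q (k ℕ.+ d) → AlphaEvaluation k
    alphaEvaluation-from k e d h h′ = sym (begin
      (1# - q) * (pow q k * alpha q k)
        ≈⟨ *-congˡ (*-congˡ (trans h (signPow-* e _))) ⟩
      (1# - q) * (pow q k * (signPow e 1# * (pow q d * Σ)))
        ≈⟨ solve 5 (λ a b c d e → a :* (b :* (c :* (d :* e))) := (c :* (b :* d)) :* (a :* e)) refl _ _ _ _ _ ⟩
      (signPow e 1# * (pow q k * pow q d)) * ((1# - q) * Σ)
        ≈⟨ *-cong (trans (*-congˡ (sym (pow-+ q k d))) (sym h′)) (geometric (suc (k ℕ.+ k))) ⟩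
      (pow q (k ℕ.* k) * A.alt (k ℕ.+ k)) * (1# - pow q (suc (k ℕ.+ k)))
        ≈⟨ solve 3 (λ a b c → (a :* b) :* c := a :* (c :* b)) refl _ _ _ ⟩
      pow q (k ℕ.* k) * ((1# - pow q (suc (k ℕ.+ k))) * A.alt (k ℕ.+ k)) ∎)
      where Σ = sumTo (suc (k ℕ.+ k)) (λ i → pow q i)

    pow-cancel : ∀ m n → pow q (m ℕ.+ n) * pow u n ≈ pow q m
    pow-cancel m n = trans (*-congʳ (pow-+ q m n))
      (trans (*-assoc _ _ _) (trans (*-congˡ (pow-inverse qu n)) (*-identityʳ _)))

    1+2*≡ : ∀ k → suc (2 ℕ.* k) ≡ suc (k ℕ.+ k)
    1+2*≡ = ℕSolver.solve-∀

    alphaEvaluation-3t : ∀ t → AlphaEvaluation (t ℕ.* 3)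
    alphaEvaluation-3t t = alphaEvaluation-from k (t ℕ.* 2 ℕ.+ t ℕ.* 2) (t ℕ.* (k ℕ.∸ 2))
      (trans (alpha-0 k ([m+kn]%n≡m%n 0 t 3))
             (alphaValue-cong e≡ (≡.trans (≡.cong (_/ 3) (d≡ t (k ℕ.∸ 2))) (m*n/n≡m (t ℕ.* (k ℕ.∸ 2)) 3)) (1+2*≡ k)))
      (begin
        pow q (k ℕ.* k) * A.alt (k ℕ.+ k)
          ≈⟨ *-cong (pow-≡ q (square t)) (reflexive (≡.cong A.alt (twice t))) ⟩
        pow q ((3 ℕ.* (t ℕ.* t) ℕ.+ 6 ℕ.* (t ℕ.* t))) * A.alt (t ℕ.* 6)
          ≈⟨ *-congˡ alt-value ⟩
        pow q ((3 ℕ.* (t ℕ.* t) ℕ.+ 6 ℕ.* (t ℕ.* t))) * (pow u (6 ℕ.* (t ℕ.* t)) * pow q t)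
          ≈⟨ *-assoc _ _ _ ⟨
        (pow q ((3 ℕ.* (t ℕ.* t) ℕ.+ 6 ℕ.* (t ℕ.* t))) * pow u (6 ℕ.* (t ℕ.* t))) * pow q t
          ≈⟨ *-congʳ (pow-cancel (3 ℕ.* (t ℕ.* t)) (6 ℕ.* (t ℕ.* t))) ⟩
        pow q (3 ℕ.* (t ℕ.* t)) * pow q t
          ≈⟨ pow-+ q (3 ℕ.* (t ℕ.* t)) t ⟨
        pow q (3 ℕ.* (t ℕ.* t) ℕ.+ t)
          ≈⟨ pow-≡ q (exponent t) ⟩
        pow q (k ℕ.+ t ℕ.* (k ℕ.∸ 2))
          ≈⟨ trans (*-congʳ (even-sign (t ℕ.* 2))) (*-identityˡ _) ⟨
        signPow (t ℕ.* 2 ℕ.+ t ℕ.* 2) 1# * pow q (k ℕ.+ t ℕ.* (k ℕ.∸ 2)) ∎)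
      where
      k = t ℕ.* 3

      alt-value : A.alt (t ℕ.* 6) ≈ pow u (6 ℕ.* (t ℕ.* t)) * pow q t
      alt-value = linear₂ (A.alt-6t t) (pow-inverse qu t) (solve 4 (λ a U Q W →
             (a :+ Q :* W) :+ (:- a) :* :1
          := (W :* Q :+ Q :* (U :* a)) :+ (:- a) :* (Q :* U)) refl
          (A.alt (t ℕ.* 6)) (pow u t) (pow q t) (pow u (6 ℕ.* (t ℕ.* t))))

      square : ∀ t → t ℕ.* 3 ℕ.* (t ℕ.* 3) ≡ 3 ℕ.* (t ℕ.* t) ℕ.+ 6 ℕ.* (t ℕ.* t)
      square = ℕSolver.solve-∀

      twice : ∀ t → t ℕ.* 3 ℕ.+ t ℕ.* 3 ≡ t ℕ.* 6
      twice = ℕSolver.solve-∀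

      d≡ : ∀ t m → t ℕ.* 3 ℕ.* m ≡ t ℕ.* m ℕ.* 3
      d≡ = ℕSolver.solve-∀

      e≡ : (4 ℕ.* k ℕ.+ 1) / 3 ≡ t ℕ.* 2 ℕ.+ t ℕ.* 2
      e≡ = ≡.trans (≡.cong (_/ 3) (rearrange t))
        (≡.trans (+-distrib-/-∣ʳ 1 (n∣m*n (t ℕ.* 2 ℕ.+ t ℕ.* 2) {3})) (m*n/n≡m (t ℕ.* 2 ℕ.+ t ℕ.* 2) 3))
        where
        rearrange : ∀ t → 4 ℕ.* (t ℕ.* 3) ℕ.+ 1 ≡ 1 ℕ.+ (t ℕ.* 2 ℕ.+ t ℕ.* 2) ℕ.* 3
        rearrange = ℕSolver.solve-∀

      -- At t = 0 the difference truncates, but it is multiplied by t; at `suc t` it is exactly 1 +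
      -- 3t.
      exponent : ∀ t → 3 ℕ.* (t ℕ.* t) ℕ.+ t ≡ t ℕ.* 3 ℕ.+ t ℕ.* (t ℕ.* 3 ℕ.∸ 2)
      exponent zero    = ≡.refl
      exponent (suc t) = rearrange t
        where
        rearrange : ∀ t → 3 ℕ.* (suc t ℕ.* suc t) ℕ.+ suc t ≡ suc t ℕ.* 3 ℕ.+ suc t ℕ.* (1 ℕ.+ t ℕ.* 3)
        rearrange = ℕSolver.solve-∀

    alphaEvaluation-3t+1 : ∀ t → AlphaEvaluation (1 ℕ.+ t ℕ.* 3)
    alphaEvaluation-3t+1 t = begin
      pow q (k ℕ.* k) * ((1# - pow q (suc (k ℕ.+ k))) * A.alt (k ℕ.+ k))
        ≈⟨ *-congˡ (*-congˡ (trans (reflexive (≡.cong A.alt (twice t))) (A.alt-6t+2 t))) ⟩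
      pow q (k ℕ.* k) * ((1# - pow q (suc (k ℕ.+ k))) * 0#)
        ≈⟨ solve 4 (λ a b c d → a :* (b :* :0) := c :* (d :* :0)) refl _ _ _ _ ⟩
      (1# - q) * (pow q k * 0#)
        ≈⟨ *-congˡ (*-congˡ (alpha-1 k ([m+kn]%n≡m%n 1 t 3))) ⟨
      (1# - q) * (pow q k * alpha q k) ∎
      where
      k = 1 ℕ.+ t ℕ.* 3
      twice : ∀ t → (1 ℕ.+ t ℕ.* 3) ℕ.+ (1 ℕ.+ t ℕ.* 3) ≡ 2 ℕ.+ t ℕ.* 6
      twice = ℕSolver.solve-∀

    -- Here ⌊(4k+1)/3⌋ = 4t+3 is odd, matching the minus sign of `A.alt-6t+4`, and k(k-2)/3 = kt.
    -- The exponent `w` is what remains of k² beyond k + kt, and the power of u cancels it.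
    alphaEvaluation-3t+2 : ∀ t → AlphaEvaluation (2 ℕ.+ t ℕ.* 3)
    alphaEvaluation-3t+2 t = alphaEvaluation-from k (suc (h ℕ.+ h)) (k ℕ.* t)
      (trans (alpha-2 k ([m+kn]%n≡m%n 2 t 3))
             (alphaValue-cong e≡ (≡.trans (≡.cong (_/ 3) (≡.sym (ℕ.*-assoc k t 3))) (m*n/n≡m (k ℕ.* t) 3)) (1+2*≡ k)))
      (begin
        pow q (k ℕ.* k) * A.alt (k ℕ.+ k)
          ≈⟨ *-cong (pow-≡ q (square t)) (trans (reflexive (≡.cong A.alt (twice t))) (A.alt-6t+4 t)) ⟩
        pow q ((k ℕ.+ k ℕ.* t) ℕ.+ w) * - pow u w
          ≈⟨ solve 2 (λ a b → a :* :- b := :- (a :* b)) refl _ _ ⟩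
        - (pow q ((k ℕ.+ k ℕ.* t) ℕ.+ w) * pow u w)
          ≈⟨ -‿cong (pow-cancel (k ℕ.+ k ℕ.* t) w) ⟩
        - pow q (k ℕ.+ k ℕ.* t)
          ≈⟨ solve 1 (λ a → :- :1 :* a := :- a) refl _ ⟨
        - 1# * pow q (k ℕ.+ k ℕ.* t)
          ≈⟨ *-congʳ (-‿cong (even-sign h)) ⟨
        signPow (suc (h ℕ.+ h)) 1# * pow q (k ℕ.+ k ℕ.* t) ∎)
      where
      k = 2 ℕ.+ t ℕ.* 3
      h = 1 ℕ.+ t ℕ.* 2
      w = (2 ℕ.+ t ℕ.* 6) ℕ.+ t ℕ.* suc (6 ℕ.* t)

      square : ∀ t → (2 ℕ.+ t ℕ.* 3) ℕ.* (2 ℕ.+ t ℕ.* 3) ≡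
        ((2 ℕ.+ t ℕ.* 3) ℕ.+ (2 ℕ.+ t ℕ.* 3) ℕ.* t) ℕ.+ ((2 ℕ.+ t ℕ.* 6) ℕ.+ t ℕ.* suc (6 ℕ.* t))
      square = ℕSolver.solve-∀

      twice : ∀ t → (2 ℕ.+ t ℕ.* 3) ℕ.+ (2 ℕ.+ t ℕ.* 3) ≡ 4 ℕ.+ t ℕ.* 6
      twice = ℕSolver.solve-∀

      e≡ : (4 ℕ.* k ℕ.+ 1) / 3 ≡ suc (h ℕ.+ h)
      e≡ = ≡.trans (≡.cong (_/ 3) (rearrange t)) (m*n/n≡m (suc (h ℕ.+ h)) 3)
        where
        rearrange : ∀ t → 4 ℕ.* (2 ℕ.+ t ℕ.* 3) ℕ.+ 1 ≡ suc ((1 ℕ.+ t ℕ.* 2) ℕ.+ (1 ℕ.+ t ℕ.* 2)) ℕ.* 3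
        rearrange = ℕSolver.solve-∀

    alphaEvaluation : ∀ k → AlphaEvaluation k
    alphaEvaluation k = ≡.subst AlphaEvaluation (≡.sym (m≡m%n+[m/n]*n k 3)) (residue (k % 3) (m%n<n k 3))
      where
      residue : ∀ r → r < 3 → AlphaEvaluation (r ℕ.+ k / 3 ℕ.* 3)
      residue 0 _ = alphaEvaluation-3t (k / 3)
      residue 1 _ = alphaEvaluation-3t+1 (k / 3)
      residue 2 _ = alphaEvaluation-3t+2 (k / 3)
      residue (suc (suc (suc _))) (s≤s (s≤s (s≤s ())))

    H-columns : ∀ p → H (suc p) N q ≈ sumTo N (λ k → weight (suc p) k * columnSum k)
    H-columns p = begin
      sumTo N (λ n → pow q n * pochPow (suc n) (suc n) * G q p n)
        ≈⟨ sumTo-cong< N (λ n n<N → trans (*-assoc _ _ _) (trans (*-congˡ (G-pair p n n<N)) (sym (sumTo-*ˡ N _ _)))) ⟩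
      sumTo N (λ n → sumTo N (λ k → pow q n * (weight (suc p) k * midbin n k)))
        ≈⟨ sumTo-swap N N _ ⟩
      sumTo N (λ k → sumTo N (λ n → pow q n * (weight (suc p) k * midbin n k)))
        ≈⟨ sumTo-cong N (λ k → trans
             (sumTo-cong N (λ n → solve 3 (λ a b c → a :* (b :* c) := b :* (a :* c)) refl _ _ _)) (sumTo-*ˡ N _ _)) ⟩
      sumTo N (λ k → weight (suc p) k * columnSum k) ∎

    summand : ℕ → ℕ → Carrier
    summand p k = signPow k (pow q (tri k ℕ.+ p ℕ.* (k ℕ.* k ℕ.+ k)) * alpha q k)

    weight-alt : ∀ p k → weight (suc p) k * (pow u (suc k) * A.alt (k ℕ.+ k)) ≈ (u * (1# - q)) * summand p k
    weight-alt p k = begin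
      (pow q (suc p ℕ.* (k ℕ.* suc k)) * (s * (C * M))) * ((u * pow u k) * A.alt (k ℕ.+ k))
        ≈⟨ *-congʳ (*-congʳ (trans (pow-≡ q (exponent p k)) (trans (pow-+ q (k ℕ.* k ℕ.+ k) _) (*-congʳ (pow-+ q (k ℕ.* k) k))))) ⟩
      (((pow q (k ℕ.* k) * pow q k) * P) * (s * (C * M))) * ((u * pow u k) * A.alt (k ℕ.+ k))
        ≈⟨ solve 9 (λ a b p s c m u U x → (((a :* b) :* p) :* (s :* (c :* m))) :* ((u :* U) :* x)
                 := (b :* U) :* (u :* s :* c :* p :* (a :* (m :* x)))) refl _ _ _ _ _ _ _ _ _ ⟩
      (pow q k * pow u k) * (u * s * C * P * (pow q (k ℕ.* k) * (M * A.alt (k ℕ.+ k))))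
        ≈⟨ trans (*-cong (pow-inverse qu k) (*-congˡ (alphaEvaluation k))) (*-identityˡ _) ⟩
      u * s * C * P * ((1# - q) * (pow q k * alpha q k))
        ≈⟨ solve 7 (λ u s c p m b x → u :* s :* c :* p :* (m :* (b :* x))
                 := (u :* m) :* (s :* (((c :* b) :* p) :* x))) refl _ _ _ _ _ _ _ ⟩
      (u * (1# - q)) * (s * (((C * pow q k) * P) * alpha q k))
        ≈⟨ *-congˡ (*-congˡ (*-congʳ (*-congʳ (trans (sym (pow-+ q (choose₂ k) k)) (pow-≡ q (≡.sym (choose₂-/ k))))))) ⟩
      (u * (1# - q)) * (s * ((pow q (tri k) * P) * alpha q k))
        ≈⟨ *-congˡ (trans (signPow-* k _) (*-congˡ (*-congʳ (pow-+ q (tri k) _)))) ⟨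
      (u * (1# - q)) * summand p k ∎
      where
      s = signPow k 1#
      C = pow q (choose₂ k)
      M = 1# - pow q (suc (k ℕ.+ k))
      P = pow q (p ℕ.* (k ℕ.* k ℕ.+ k))
      exponent : ∀ p k → suc p ℕ.* (k ℕ.* suc k) ≡ (k ℕ.* k ℕ.+ k) ℕ.+ p ℕ.* (k ℕ.* k ℕ.+ k)
      exponent = ℕSolver.solve-∀

  H-formula : ∀ p → H (suc p) N q ≈ - (u * (1# - q) * RHSsum (suc p) N q)
  H-formula p = begin
    H (suc p) N q
      ≈⟨ H-columns p ⟩
    sumTo N (λ k → weight (suc p) k * columnSum k)
      -- Reversal brings in the columns N-1-k, the ones with an evaluation independent of N;
      -- `weight-reflect` then returns the weight to index k.
      ≈⟨ sumTo-reverse N′ _ ⟩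
    sumTo N (λ k → weight (suc p) (N′ ℕ.∸ k) * columnSum (N′ ℕ.∸ k))
      ≈⟨ sumTo-cong< N (λ k k<N → let k+k′ = ℕ.m+[n∸m]≡n (ℕ.s≤s⁻¹ k<N) in begin
           weight (suc p) (N′ ℕ.∸ k) * columnSum (N′ ℕ.∸ k)
             ≈⟨ *-cong (weight-reflect (suc p) k (N′ ℕ.∸ k) k+k′) (columnSum-reflect k (N′ ℕ.∸ k) k+k′) ⟩
           - weight (suc p) k * (pow u (suc k) * A.alt (k ℕ.+ k))
             ≈⟨ solve 2 (λ a b → :- a :* b := :- (a :* b)) refl _ _ ⟩
           - (weight (suc p) k * (pow u (suc k) * A.alt (k ℕ.+ k)))
             ≈⟨ -‿cong (weight-alt p k) ⟩
           - ((u * (1# - q)) * summand p k) ∎) ⟩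
    sumTo N (λ k → - ((u * (1# - q)) * summand p k))
      ≈⟨ trans (sumTo-neg N _) (-‿cong (sumTo-*ˡ N _ _)) ⟩
    - (u * (1# - q) * RHSsum (suc p) N q) ∎

theorem2p12 : ∀ {c ℓ : Level} (R : CommutativeRing c ℓ) →
    let open CommutativeRing R in let open Over R in
    IsIntegralDomainChar0 →
    ∀ (p N : ℕ) → 1 ≤ p → 1 ≤ N → (q : Carrier) → PrimitiveRoot N q →
    (qinv : Carrier) → q * qinv ≈ 1# →
    H p N q ≈ - (qinv * (1# + - q) * RHSsum p N q)
theorem2p12 R domain (suc p) (suc N′) _ _ q root qinv qu = RootOfUnity.H-formula R domain N′ q qinv root qu p
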